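{- $f(n,3,4)\ge (1-o(1))(n/3)^{1/5}$, where the $o(1)$ term tends to $0$ as $n\to\infty$.
   Context: A $3$-digraph $G$ consists of a finite vertex set $V(G)$ and an edge set $E(G)$ whose elements are ordered triples of distinct vertices. A $(3,k)$-tournament is a $3$-digraph $G$ such that for every $3$-element set $S\subseteq V(G)$, exactly $k$ of the $6$ orderings of $S$ are edges of $G$. The tight path $P^{(3)}_s$ is the $3$-digraph with $s$ distinct vertices $v_1,\ldots,v_s$ whose edges are exactly the triples $(v_i,v_{i+1},v_{i+2})$, $1\le i\le s-2$ (no edges if $s<3$). A $3$-digraph $G$ contains $P^{(3)}_s$ if there is an injection of its vertices into $V(G)$ mapping edges to edges. $f(n,3,k)$ is the maximum integer $s$ such that every $n$-vertex $(3,k)$-tournament contains a copy of $P^{(3)}_s$. -}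

module Defs where

open import Data.Bool.Base using (Bool; true; false; T; not; _∧_; if_then_else_)
open import Data.Bool.Properties using (T-∧; T?; ∧-zeroʳ)
open import Data.Fin.Base using (Fin; toℕ; finToFun; funToFin; combine; remQuot)
open import Data.Fin.Properties
  using (2↔Bool; any?; all?; _<?_; <-cmp; <-trans; finToFun-funToFin; remQuot-combine; injective⇒≤)
  renaming (_≟_ to _≟ᶠ_)
open import Data.Integer.Base using (+_)
open import Data.List.Base using (List; []; _∷_; length; map; filterᵇ)
open import Data.List.Properties using (map-cong)
open import Data.Nat.Base as ℕ using (ℕ; zero; suc; s≤s; _≡ᵇ_; _<ᵇ_)
import Data.Nat.Properties as ℕ
open import Data.Product.Base using (∃; _×_; _,_; proj₁; proj₂; map₂)
open import Data.Sum.Base using (inj₁; inj₂)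
open import Data.Rational.Base as ℚ using (ℚ; _/_)
open import Algebra.Definitions.RawSemiring ℚ.+-*-rawSemiring using (_^_)
open import Function.Base using (_∘_; id)
open import Function.Bundles using (Equivalence; Inverse)
open import Function.Definitions using (Injective)
open import Relation.Binary.Definitions using (tri<; tri≈; tri>)
open import Relation.Binary.PropositionalEquality
open import Relation.Nullary.Decidable
  using (Dec; yes; no; does; map′; _×-dec_; _→-dec_; ¬?; dec-true; dec-false)
open import Relation.Nullary.Negation using (contradiction)

private
  variable
    m n k s : ℕ

Distinct : {A : Set} → A → A → A → Set
Distinct a b c = a ≢ b × a ≢ c × b ≢ c

record Digraph₃ (n : ℕ) : Set where
  field
    edge          : Fin n → Fin n → Fin n → Bool
    edge⇒distinct : ∀ {a b c} → T (edge a b c) → Distinct a b c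

open Digraph₃ public

edgeAt : Digraph₃ n → Fin n × Fin n × Fin n → Bool
edgeAt G (a , b , c) = edge G a b c

orderings : {A : Set} → A → A → A → List (A × A × A)
orderings a b c =
  (a , b , c) ∷ (a , c , b) ∷ (b , a , c) ∷ (b , c , a) ∷ (c , a , b) ∷ (c , b , a) ∷ []

#edgesOn : Digraph₃ n → Fin n → Fin n → Fin n → ℕ
#edgesOn G a b c = length (filterᵇ (edgeAt G) (orderings a b c))

IsTournament₃ : ℕ → Digraph₃ n → Set
IsTournament₃ k G = ∀ a b c → Distinct a b c → #edgesOn G a b c ≡ k

tightPath : ∀ s → Digraph₃ s
tightPath s .edge a b c = (toℕ b ≡ᵇ suc (toℕ a)) ∧ (toℕ c ≡ᵇ suc (toℕ b))
tightPath s .edge⇒distinct {a} {b} {c} e =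
    (λ a≡b → ℕ.<⇒≢ a<b (cong toℕ a≡b))
  , (λ a≡c → ℕ.<⇒≢ (ℕ.<-trans a<b b<c) (cong toℕ a≡c))
  , (λ b≡c → ℕ.<⇒≢ b<c (cong toℕ b≡c))
  where
  b≡1+a,c≡1+b = Equivalence.to T-∧ e
  a<b : toℕ a ℕ.< toℕ b
  a<b = ℕ.≤-reflexive (sym (ℕ.≡ᵇ⇒≡ _ _ (proj₁ b≡1+a,c≡1+b)))
  b<c : toℕ b ℕ.< toℕ c
  b<c = ℕ.≤-reflexive (sym (ℕ.≡ᵇ⇒≡ _ _ (proj₂ b≡1+a,c≡1+b)))

IsCopy : Digraph₃ n → Digraph₃ m → (Fin m → Fin n) → Set
IsCopy G H φ =
  Injective _≡_ _≡_ φ × (∀ a b c → T (edge H a b c) → T (edge G (φ a) (φ b) (φ c)))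

Contains : Digraph₃ n → Digraph₃ m → Set
Contains G H = ∃ (IsCopy G H)

AllContainPath : (n k s : ℕ) → Set
AllContainPath n k s = (G : Digraph₃ n) → IsTournament₃ k G → Contains G (tightPath s)

IsMaximum : (ℕ → Set) → ℕ → Set
IsMaximum P s = P s × (∀ t → P t → t ℕ.≤ s)

-- AllContainPath is decidable, since up to pointwise equality there are only
-- finitely many edge functions and vertex maps; its maximum can therefore be
-- computed.

anyFunction? : {P : (Fin m → Fin n) → Set} →
               (∀ {φ ψ} → φ ≗ ψ → P φ → P ψ) → (∀ φ → Dec (P φ)) → Dec (∃ P)
anyFunction? resp P? = map′
  (λ (i , p) → finToFun i , p)
  (λ (φ , p) → funToFin φ , resp (sym ∘ finToFun-funToFin φ) p)
  (any? (P? ∘ finToFun))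

_≈_ : Digraph₃ n → Digraph₃ n → Set
G ≈ H = ∀ a b c → edge G a b c ≡ edge H a b c

distinct? : (a b c : Fin n) → Dec (Distinct a b c)
distinct? a b c = ¬? (a ≟ᶠ b) ×-dec ¬? (a ≟ᶠ c) ×-dec ¬? (b ≟ᶠ c)

witness : {P : Set} (P? : Dec P) → T (does P?) → P
witness (yes p) _ = p

decode : (Fin (n ℕ.* (n ℕ.* n)) → Fin 2) → Digraph₃ n
decode φ .edge a b c =
  does (distinct? a b c) ∧ Inverse.to 2↔Bool (φ (combine a (combine b c)))
decode φ .edge⇒distinct {a} {b} {c} e =
  witness (distinct? a b c) (proj₁ (Equivalence.to T-∧ e))

encode : Digraph₃ n → Fin (n ℕ.* (n ℕ.* n)) → Fin 2
encode {n} G i = Inverse.from 2↔Bool (edgeAt G (map₂ (remQuot n) (remQuot (n ℕ.* n) i)))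

decode-cong : (φ ψ : Fin (n ℕ.* (n ℕ.* n)) → Fin 2) → φ ≗ ψ → decode {n} φ ≈ decode {n} ψ
decode-cong _ _ φ≗ψ a b c =
  cong (λ i → does (distinct? a b c) ∧ Inverse.to 2↔Bool i) (φ≗ψ (combine a (combine b c)))

encode-combine : (G : Digraph₃ n) → ∀ a b c →
                 Inverse.to 2↔Bool (encode G (combine a (combine b c))) ≡ edge G a b c
encode-combine {n} G a b c = trans
  (Inverse.inverseˡ 2↔Bool refl)
  (trans (cong (edgeAt G ∘ map₂ (remQuot n)) (remQuot-combine a (combine b c)))
         (cong (λ bc → edgeAt G (a , bc)) (remQuot-combine b c)))

distinct∧edge : (G : Digraph₃ n) → ∀ a b c →
                does (distinct? a b c) ∧ edge G a b c ≡ edge G a b c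
distinct∧edge G a b c with edge G a b c in eq
... | false = ∧-zeroʳ (does (distinct? a b c))
... | true  =
  cong (_∧ true) (dec-true (distinct? a b c) (edge⇒distinct G (subst T (sym eq) _)))

decode-encode : (G : Digraph₃ n) → decode {n} (encode G) ≈ G
decode-encode G a b c = trans
  (cong (does (distinct? a b c) ∧_) (encode-combine G a b c))
  (distinct∧edge G a b c)

allDigraphs? : {P : Digraph₃ n → Set} →
               (∀ {G H} → G ≈ H → P G → P H) → (∀ G → Dec (P G)) → Dec (∀ G → P G)
allDigraphs? {n} resp P? = map′
  (λ p G → resp (λ a b c → trans (recode G a b c) (decode-encode G a b c))
                (p (funToFin (encode G))))
  (λ p i → p (decode (finToFun i)))
  (all? {n = 2 ℕ.^ (n ℕ.* (n ℕ.* n))} (λ i → P? (decode (finToFun i))))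
  where
  recode : (G : Digraph₃ n) → decode {n} (finToFun (funToFin (encode G))) ≈ decode {n} (encode G)
  recode G = decode-cong {n} _ _ (finToFun-funToFin (encode G))

length-filterᵇ : {A : Set} (p : A → Bool) (xs : List A) →
                 length (filterᵇ p xs) ≡ length (filterᵇ id (map p xs))
length-filterᵇ p []       = refl
length-filterᵇ p (x ∷ xs) with p x
... | true  = cong suc (length-filterᵇ p xs)
... | false = length-filterᵇ p xs

#edgesOn-cong : (G H : Digraph₃ n) → G ≈ H → ∀ a b c → #edgesOn G a b c ≡ #edgesOn H a b c
#edgesOn-cong G H G≈H a b c = begin
  length (filterᵇ (edgeAt G) abc)          ≡⟨ length-filterᵇ (edgeAt G) abc ⟩
  length (filterᵇ id (map (edgeAt G) abc)) ≡⟨ cong (length ∘ filterᵇ id) (map-cong (λ (x , y , z) → G≈H x y z) abc) ⟩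
  length (filterᵇ id (map (edgeAt H) abc)) ≡⟨ length-filterᵇ (edgeAt H) abc ⟨
  length (filterᵇ (edgeAt H) abc)          ∎
  where
  open ≡-Reasoning
  abc = orderings a b c

isTournament₃-resp : {G H : Digraph₃ n} → G ≈ H → IsTournament₃ k G → IsTournament₃ k H
isTournament₃-resp {G = G} {H} G≈H t a b c d =
  trans (sym (#edgesOn-cong G H G≈H a b c)) (t a b c d)

contains-resp : {G H : Digraph₃ n} {K : Digraph₃ m} → G ≈ H → Contains G K → Contains H K
contains-resp G≈H (φ , inj , hom) =
  φ , inj , λ a b c e → subst T (G≈H (φ a) (φ b) (φ c)) (hom a b c e)

isTournament₃? : ∀ k (G : Digraph₃ n) → Dec (IsTournament₃ k G)
isTournament₃? k G =
  all? λ a → all? λ b → all? λ c → distinct? a b c →-dec (#edgesOn G a b c ℕ.≟ k)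

isCopy? : (G : Digraph₃ n) (H : Digraph₃ m) (φ : Fin m → Fin n) → Dec (IsCopy G H φ)
isCopy? G H φ =
  map′ (λ inj {a} {b} → inj a b) (λ inj a b → inj {a} {b})
       (all? λ a → all? λ b → (φ a ≟ᶠ φ b) →-dec (a ≟ᶠ b))
  ×-dec
  all? λ a → all? λ b → all? λ c → T? (edge H a b c) →-dec T? (edge G (φ a) (φ b) (φ c))

isCopy-resp : (G : Digraph₃ n) (H : Digraph₃ m) {φ ψ : Fin m → Fin n} →
              φ ≗ ψ → IsCopy G H φ → IsCopy G H ψ
isCopy-resp G H {φ} {ψ} φ≗ψ (inj , hom) =
    (λ {a} {b} ψa≡ψb → inj (trans (φ≗ψ a) (trans ψa≡ψb (sym (φ≗ψ b)))))
  , hom-ψ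
  where
  hom-ψ : ∀ a b c → T (edge H a b c) → T (edge G (ψ a) (ψ b) (ψ c))
  hom-ψ a b c e rewrite sym (φ≗ψ a) | sym (φ≗ψ b) | sym (φ≗ψ c) = hom a b c e

contains? : (G : Digraph₃ n) (H : Digraph₃ m) → Dec (Contains G H)
contains? G H = anyFunction? (isCopy-resp G H) (isCopy? G H)

allContainPath? : ∀ n k s → Dec (AllContainPath n k s)
allContainPath? n k s = allDigraphs?
  (λ {G} {H} G≈H p t → contains-resp {G = G} {H} {tightPath s} G≈H
    (p (isTournament₃-resp {G = H} {G} (λ a b c → sym (G≈H a b c)) t)))
  (λ G → isTournament₃? k G →-dec contains? G (tightPath s))

largest≤ : {P : ℕ → Set} → (∀ s → Dec (P s)) → ℕ → ℕ
largest≤ P? zero    = zero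
largest≤ P? (suc b) = if does (P? (suc b)) then suc b else largest≤ P? b

-- f(n,3,k). A copy of tightPath s needs s distinct vertices, so searching up to
-- n finds the maximum whenever there is a (3,k)-tournament on n vertices, in
-- particular for all k ≤ 6: see f₃-isMaximum.
f₃ : (n k : ℕ) → ℕ
f₃ n k = largest≤ (allContainPath? n k) n

largest≤-sat : {P : ℕ → Set} (P? : ∀ s → Dec (P s)) → P 0 → ∀ b → P (largest≤ P? b)
largest≤-sat P? p0 zero = p0
largest≤-sat P? p0 (suc b) with P? (suc b)
... | yes p = p
... | no  _ = largest≤-sat P? p0 b

largest≤-max : {P : ℕ → Set} (P? : ∀ s → Dec (P s)) →
               ∀ b t → t ℕ.≤ b → P t → t ℕ.≤ largest≤ P? b
largest≤-max P? zero t t≤0 _ = t≤0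
largest≤-max P? (suc b) t t≤1+b pt with P? (suc b)
... | yes _ = t≤1+b
... | no ¬p with ℕ.m≤n⇒m<n∨m≡n t≤1+b
...   | inj₁ (s≤s t≤b) = largest≤-max P? b t t≤b pt
...   | inj₂ refl      = contradiction pt ¬p

-- The position in orderings a b c of the increasing arrangement, read off from
-- the truth values of a < b, a < c and b < c (6 for the two impossible patterns).
-- Ranks of the six orderings are then 0,…,5 in some order, so keeping the ranks
-- below k gives a (3,k)-tournament.
rank : Bool → Bool → Bool → ℕ
rank true  true  true  = 0
rank true  true  false = 1
rank false true  true  = 2
rank false false true  = 3
rank true  false false = 4
rank false false false = 5
rank true  false true  = 6
rank false true  false = 6

lt : Fin n → Fin n → Bool
lt a b = does (a <? b)

ranked : ∀ n k → Digraph₃ n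
ranked n k .edge a b c =
  does (distinct? a b c) ∧ (rank (lt a b) (lt a c) (lt b c) <ᵇ k)
ranked n k .edge⇒distinct {a} {b} {c} e =
  witness (distinct? a b c) (proj₁ (Equivalence.to T-∧ e))

lt-flip : {a b : Fin n} → a ≢ b → lt b a ≡ not (lt a b)
lt-flip {a = a} {b} a≢b with <-cmp a b
... | tri< a<b _ b≮a rewrite dec-true (a <? b) a<b | dec-false (b <? a) b≮a = refl
... | tri≈ _ a≡b _ = contradiction a≡b a≢b
... | tri> a≮b _ b<a rewrite dec-false (a <? b) a≮b | dec-true (b <? a) b<a = refl

lt-trans : (a b c : Fin n) → lt a b ≡ true → lt b c ≡ true → lt a c ≡ true
lt-trans a b c p q = dec-true (a <? c) (<-trans
  (witness (a <? b) (subst T (sym p) _))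
  (witness (b <? c) (subst T (sym q) _)))

≤6-cases : {P : ℕ → Set} → P 0 → P 1 → P 2 → P 3 → P 4 → P 5 → P 6 → k ℕ.≤ 6 → P k
≤6-cases {0} p0 _ _ _ _ _ _ _ = p0
≤6-cases {1} _ p1 _ _ _ _ _ _ = p1
≤6-cases {2} _ _ p2 _ _ _ _ _ = p2
≤6-cases {3} _ _ _ p3 _ _ _ _ = p3
≤6-cases {4} _ _ _ _ p4 _ _ _ = p4
≤6-cases {5} _ _ _ _ _ p5 _ _ = p5
≤6-cases {6} _ _ _ _ _ _ p6 _ = p6
≤6-cases {suc (suc (suc (suc (suc (suc (suc _))))))} _ _ _ _ _ _ _
  (s≤s (s≤s (s≤s (s≤s (s≤s (s≤s ()))))))

rankBits : ℕ → Bool → Bool → Bool → List Bool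
rankBits k p q r =
  map (_<ᵇ k)
    ( rank p q r ∷ rank q p (not r) ∷ rank (not p) r q
    ∷ rank r (not p) (not q) ∷ rank (not q) (not r) p ∷ rank (not r) (not q) (not p) ∷ [])

ranked-edges : ∀ n k {a b c} → Distinct a b c →
               map (edgeAt (ranked n k)) (orderings a b c) ≡ rankBits k (lt a b) (lt a c) (lt b c)
ranked-edges n k {a} {b} {c} (a≢b , a≢c , b≢c)
  rewrite dec-true (distinct? a b c) (a≢b , a≢c , b≢c)
        | dec-true (distinct? a c b) (a≢c , a≢b , b≢c ∘ sym)
        | dec-true (distinct? b a c) (a≢b ∘ sym , b≢c , a≢c)
        | dec-true (distinct? b c a) (b≢c , a≢b ∘ sym , a≢c ∘ sym)
        | dec-true (distinct? c a b) (a≢c ∘ sym , b≢c ∘ sym , a≢b)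
        | dec-true (distinct? c b a) (b≢c ∘ sym , a≢c ∘ sym , a≢b ∘ sym)
        | lt-flip a≢b | lt-flip a≢c | lt-flip b≢c = refl

Balanced : Bool → Bool → Bool → ℕ → Set
Balanced p q r k = length (filterᵇ id (rankBits k p q r)) ≡ k

balanced : ∀ p q r → (p ≡ true → r ≡ true → q ≡ true) → (p ≡ false → q ≡ true → r ≡ true) →
           k ℕ.≤ 6 → Balanced p q r k
balanced true  true  true  _ _ = ≤6-cases {P = Balanced true  true  true } refl refl refl refl refl refl refl
balanced true  true  false _ _ = ≤6-cases {P = Balanced true  true  false} refl refl refl refl refl refl refl
balanced false true  true  _ _ = ≤6-cases {P = Balanced false true  true } refl refl refl refl refl refl refl
balanced false false true  _ _ = ≤6-cases {P = Balanced false false true } refl refl refl refl refl refl refl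
balanced true  false false _ _ = ≤6-cases {P = Balanced true  false false} refl refl refl refl refl refl refl
balanced false false false _ _ = ≤6-cases {P = Balanced false false false} refl refl refl refl refl refl refl
balanced true  false true  h _ = contradiction (h refl refl) λ ()
balanced false true  false _ h = contradiction (h refl refl) λ ()

ranked-isTournament₃ : ∀ n k → k ℕ.≤ 6 → IsTournament₃ k (ranked n k)
ranked-isTournament₃ n k k≤6 a b c d@(a≢b , _) = trans
  (length-filterᵇ (edgeAt (ranked n k)) (orderings a b c))
  (trans (cong (length ∘ filterᵇ id) (ranked-edges n k d))
         (balanced (lt a b) (lt a c) (lt b c)
                   (lt-trans a b c)
                   (λ p → lt-trans b a c (trans (lt-flip a≢b) (cong not p)))
                   k≤6))

f₃-isMaximum : ∀ n k → k ℕ.≤ 6 → IsMaximum (AllContainPath n k) (f₃ n k)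
f₃-isMaximum n k k≤6 = largest≤-sat P? path₀ n , λ t p → largest≤-max P? n t (≤n p) p
  where
  P? = allContainPath? n k

  path₀ : AllContainPath n k 0
  path₀ _ _ = (λ ()) , (λ { {()} }) , λ ()

  ≤n : ∀ {t} → AllContainPath n k t → t ℕ.≤ n
  ≤n p = injective⇒≤ (proj₁ (proj₂ (p (ranked n k) (ranked-isTournament₃ n k k≤6))))

-- s ≥ c · x^(1/5) for real fifth roots: raising to the fifth power is strictly
-- increasing on ℝ, so no sign condition is needed.
_≥_·⁵√_ : ℚ → ℚ → ℚ → Set
s ≥ c ·⁵√ x = c ^ 5 ℚ.* x ℚ.≤ s ^ 5

{-# OPTIONS --safe #-}

-- Let G have no tight path on s vertices. The level of (a , b) is the length of
-- a longest tight path starting with a , b; along an edge abc it drops from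
-- (a , b) to (b , c) unless a lies on the chosen path from (b , c). These
-- exceptions number at most n² s, so for n ≥ 3 s⁵ the deletion method (sample s²
-- vertices, drop one per exception) leaves about 2 s² / 3 vertices without any.
-- There every triple has exactly two edges in each cyclic orientation, so the
-- levels around each oriented triangle are cyclically monotone. Let ψ a b be the
-- level of (b , a), let a ≻ b mean ψ a b ≥ ψ b a with ties broken by the order of
-- the vertices, and let y be the maximum of ψ b a over all b with a ≻ b, attained
-- at b with x = ψ a b. Then (y , x) determines a, and 0 ≤ y ≤ x ≤ s - 2, so there
-- are at most s (s - 1) / 2 < 2 s² / 3 such vertices, a contradiction.
module Submission where

open import Defs
open import Algebra.Bundles using (module CommutativeRing)
open import Data.Bool.Base using (Bool; true; false; T)
open import Data.Bool.Properties using (T-∧)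
open import Data.Empty using (⊥)
open import Data.Fin.Base as Fin using (Fin; zero; suc; toℕ; fromℕ<)
import Data.Fin.Properties as Fin
open import Data.Integer.Base as ℤ using (+_)
import Data.Integer.Properties as ℤ
open import Data.List.Base using (List; []; _∷_; length; lookup; filterᵇ)
open import Data.Nat.Base as ℕ using (ℕ; zero; suc; z≤n; s≤s; _≤_; _+_; _*_; _^_)
import Data.Nat.Properties as ℕ
open import Data.Nat.Solver using (module +-*-Solver)
open import Data.Product.Base using (∃; ∃₂; ∃-syntax; _×_; _,_; proj₁; proj₂)
open import Data.Rational.Base as ℚ using (ℚ; mkℚ; 0ℚ; 1ℚ; _<_; _-_; _/_)
import Data.Rational.Properties as ℚ
open import Data.Rational.Unnormalised.Base as ℚᵘ using (mkℚᵘ; *≡*; *≤*)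
import Data.Rational.Unnormalised.Properties as ℚᵘ
open import Data.Sum.Base using (_⊎_; inj₁; inj₂)
open import Data.Unit.Base using (⊤; tt)
open import Data.Vec.Functional using () renaming (_∷_ to _◂_)
open import Function.Base using (_∘_; id)
open import Function.Bundles using (Equivalence)
open import Relation.Binary.Definitions using (Tri; tri<; tri≈; tri>)
open import Relation.Binary.PropositionalEquality
open import Relation.Nullary.Decidable using (Dec; yes; no; _×-dec_; _⊎-dec_)
open import Relation.Nullary.Negation using (¬_; contradiction)
open import Algebra.Definitions.RawSemiring ℚ.+-*-rawSemiring using () renaming (_^_ to _^ℚ_)
open import Algebra.Properties.CommutativeSemiring.Exp (CommutativeRing.commutativeSemiring ℚ.+-*-commutativeRing) using (^-distrib-*)
open import Algebra.Properties.Semiring.Sum ℕ.+-*-semiring using (sum; sum-cong-≗; ∑-distrib-+; ∑-comm; *-distribˡ-sum)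

-- Cyclically increasing levels

Increasing↻ : ℕ → ℕ → ℕ → Set
Increasing↻ x y z = (x ℕ.< y × y ℕ.< z) ⊎ (y ℕ.< z × z ℕ.< x) ⊎ (z ℕ.< x × x ℕ.< y)

¬increasing↻-repeat : ∀ {x z} → ¬ Increasing↻ x x z
¬increasing↻-repeat (inj₁ (x<x , _))        = ℕ.<-irrefl refl x<x
¬increasing↻-repeat (inj₂ (inj₁ (p , q)))   = ℕ.<-asym p q
¬increasing↻-repeat (inj₂ (inj₂ (_ , x<x))) = ℕ.<-irrefl refl x<x

-- A weak inequality between two cyclically adjacent values decides which rotation is the increasing
-- one, so the cyclic order unrolls to a linear one.
increasing↻-between : ∀ {x y z} → x ≤ z → Increasing↻ x y z → x ℕ.< y × y ℕ.< z
increasing↻-between x≤z (inj₁ p)               = p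
increasing↻-between x≤z (inj₂ (inj₁ (_ , z<x))) = contradiction z<x (ℕ.≤⇒≯ x≤z)
increasing↻-between x≤z (inj₂ (inj₂ (z<x , _))) = contradiction z<x (ℕ.≤⇒≯ x≤z)

increasing↻-below : ∀ {x y z} → y ≤ x → Increasing↻ x y z → y ℕ.< z × z ℕ.< x
increasing↻-below y≤x (inj₁ (x<y , _))        = contradiction x<y (ℕ.≤⇒≯ y≤x)
increasing↻-below y≤x (inj₂ (inj₁ p))         = p
increasing↻-below y≤x (inj₂ (inj₂ (_ , x<y))) = contradiction x<y (ℕ.≤⇒≯ y≤x)

maximiser : ∀ {m} {P : Fin m → Set} → (∀ i → Dec (P i)) → (f : Fin m → ℕ) →
            (∀ i → ¬ P i) ⊎ ∃ λ i → P i × (∀ j → P j → f j ≤ f i)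
maximiser {zero} P? f = inj₁ λ ()
maximiser {suc m} P? f with P? zero | maximiser (P? ∘ suc) (f ∘ suc)
... | no ¬p | inj₁ none = inj₁ λ { zero → ¬p ; (suc i) → none i }
... | no ¬p | inj₂ (i , p , max) =
  inj₂ (suc i , p , λ { zero q → contradiction q ¬p ; (suc j) q → max j q })
... | yes p | inj₁ none =
  inj₂ (zero , p , λ { zero _ → ℕ.≤-refl ; (suc j) q → contradiction q (none j) })
... | yes p | inj₂ (i , q , max) with ℕ.≤-total (f (suc i)) (f zero)
...   | inj₁ fi≤f0 = inj₂ (zero , p , λ { zero _ → ℕ.≤-refl ; (suc j) r → ℕ.≤-trans (max j r) fi≤f0 })
...   | inj₂ f0≤fi = inj₂ (suc i , q , λ { zero _ → f0≤fi ; (suc j) r → max j r })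

-- Triangular numbers and the staircase coding of pairs

triangle : ℕ → ℕ
triangle zero    = zero
triangle (suc k) = triangle k + suc k

triangle-mono : ∀ {j k} → j ≤ k → triangle j ≤ triangle k
triangle-mono z≤n       = z≤n
triangle-mono (s≤s j≤k) = ℕ.+-mono-≤ (triangle-mono j≤k) (s≤s j≤k)

2*triangle : ∀ k → 2 * triangle k ≡ k * suc k
2*triangle zero    = refl
2*triangle (suc k) = begin
  2 * (triangle k + suc k)     ≡⟨ ℕ.*-distribˡ-+ 2 (triangle k) (suc k) ⟩
  2 * triangle k + 2 * suc k   ≡⟨ cong (_+ 2 * suc k) (2*triangle k) ⟩
  k * suc k + 2 * suc k        ≡⟨ ℕ.*-distribʳ-+ (suc k) k 2 ⟨
  (k + 2) * suc k              ≡⟨ cong (_* suc k) (ℕ.+-comm k 2) ⟩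
  (2 + k) * suc k              ≡⟨ ℕ.*-comm (2 + k) (suc k) ⟩
  suc k * (2 + k)              ∎
  where open ≡-Reasoning

-- Row x of the staircase holds the x + 1 codes starting at `triangle x`, and all of them precede
-- every later row.
triangle-row : ∀ {x y j} → y ≤ x → x ℕ.< j → triangle x + y ℕ.< triangle j
triangle-row {x} y≤x x<j =
  ℕ.<-≤-trans (ℕ.+-monoʳ-< (triangle x) (s≤s y≤x)) (triangle-mono x<j)

triangle-injective : ∀ {x y x′ y′} → y ≤ x → y′ ≤ x′ →
                     triangle x + y ≡ triangle x′ + y′ → x ≡ x′ × y ≡ y′
triangle-injective {x} {y} {x′} {y′} y≤x y′≤x′ eq with ℕ.<-cmp x x′
... | tri< x<x′ _ _ = contradiction eq
  (ℕ.<⇒≢ (ℕ.<-≤-trans (triangle-row y≤x x<x′) (ℕ.m≤m+n (triangle x′) y′)))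
... | tri> _ _ x′<x = contradiction (sym eq)
  (ℕ.<⇒≢ (ℕ.<-≤-trans (triangle-row y′≤x′ x′<x) (ℕ.m≤m+n (triangle x) y)))
... | tri≈ _ refl _ = refl , ℕ.+-cancelˡ-≡ (triangle x) y y′ eq

-- The tournament is forgotten here: what remains is a bounded function on ordered pairs whose
-- values around every triangle, in both orientations, are in cyclic order.
module CyclicLevels
  {m B : ℕ} (ψ : Fin m → Fin m → ℕ)
  (ψ≤B : ∀ a b → ψ a b ≤ B)
  (ψ>0 : ∀ {a b} → a ≢ b → 0 ℕ.< ψ a b)
  (increasing : ∀ {a b c} → Distinct a b c → Increasing↻ (ψ a b) (ψ b c) (ψ c a))
  where

  _≻_ : Fin m → Fin m → Set
  a ≻ b = ψ b a ℕ.< ψ a b ⊎ (ψ b a ≡ ψ a b × toℕ b ℕ.< toℕ a)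

  _≻?_ : ∀ a b → Dec (a ≻ b)
  a ≻? b = (ψ b a ℕ.<? ψ a b) ⊎-dec ((ψ b a ℕ.≟ ψ a b) ×-dec (toℕ b ℕ.<? toℕ a))

  ≻⇒≤ : ∀ {a b} → a ≻ b → ψ b a ≤ ψ a b
  ≻⇒≤ (inj₁ <ψ)       = ℕ.<⇒≤ <ψ
  ≻⇒≤ (inj₂ (≡ψ , _)) = ℕ.≤-reflexive ≡ψ

  ≻-asym : ∀ {a b} → a ≻ b → ¬ b ≻ a
  ≻-asym (inj₁ p)        b≻a             = ℕ.<⇒≱ p (≻⇒≤ b≻a)
  ≻-asym (inj₂ (eq , _)) (inj₁ q)        = ℕ.<⇒≢ q (sym eq)
  ≻-asym (inj₂ (_ , p))  (inj₂ (_ , q))  = ℕ.<-asym p q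

  ≻-irrefl : ∀ {a} → ¬ a ≻ a
  ≻-irrefl a≻a = ≻-asym a≻a a≻a

  ≻-total : ∀ {a b} → a ≢ b → a ≻ b ⊎ b ≻ a
  ≻-total {a} {b} a≢b with ℕ.<-cmp (ψ b a) (ψ a b)
  ... | tri< p _ _ = inj₁ (inj₁ p)
  ... | tri> _ _ p = inj₂ (inj₁ p)
  ... | tri≈ _ eq _ with ℕ.<-cmp (toℕ b) (toℕ a)
  ...   | tri< p _ _ = inj₁ (inj₂ (eq , p))
  ...   | tri> _ _ p = inj₂ (inj₂ (sym eq , p))
  ...   | tri≈ _ b≡a _ = contradiction (Fin.toℕ-injective (sym b≡a)) a≢b

  -- The alternative y ≡ 0 serves a vertex that dominates no other; it receives the pair (0 , 0). An
  -- attained y is positive, because `ψ` is positive off the diagonal.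
  record Signature (a : Fin m) (y x : ℕ) : Set where
    field
      maximal  : ∀ c → a ≻ c → ψ c a ≤ y
      attained : y ≡ 0 ⊎ ∃ λ b → a ≻ b × ψ b a ≡ y × ψ a b ≡ x
      y≤x      : y ≤ x
      x≤B      : x ≤ B

  signature : ∀ a → ∃₂ (Signature a)
  signature a with maximiser (a ≻?_) (λ c → ψ c a)
  ... | inj₁ none = 0 , 0 , record
    { maximal = λ c a≻c → contradiction a≻c (none c) ; attained = inj₁ refl
    ; y≤x = z≤n ; x≤B = z≤n }
  ... | inj₂ (b , a≻b , max) = ψ b a , ψ a b , record
    { maximal = max ; attained = inj₂ (b , a≻b , refl , refl)
    ; y≤x = ≻⇒≤ a≻b ; x≤B = ψ≤B a b }

  -- The triangles through the partners b of a and b′ of a′ are incompatible with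
  -- ψ a′ a ≤ y, which the maximality of y imposes.
  signature-clash : ∀ {a a′ y x} → Signature a y x → Signature a′ y x → ¬ a ≻ a′
  signature-clash {a} {a′} {y} {x} S S′ a≻a′ =
    case (Signature.attained S) (Signature.attained S′)
    where
    a≢a′ : a ≢ a′
    a≢a′ refl = ≻-irrefl a≻a′

    p≤y : ψ a′ a ≤ y
    p≤y = Signature.maximal S a′ a≻a′

    0<y : 0 ℕ.< y
    0<y = ℕ.<-≤-trans (ψ>0 (a≢a′ ∘ sym)) p≤y

    y≤x : y ≤ x
    y≤x = Signature.y≤x S

    Attained : Fin m → Set
    Attained a = y ≡ 0 ⊎ ∃ λ b → a ≻ b × ψ b a ≡ y × ψ a b ≡ x

    case : Attained a → Attained a′ → ⊥
    case (inj₁ y≡0) _ = ℕ.<⇒≢ 0<y (sym y≡0)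
    case (inj₂ _) (inj₁ y≡0) = ℕ.<⇒≢ 0<y (sym y≡0)
    case (inj₂ (b , a≻b , ba≡y , ab≡x)) (inj₂ (b′ , a′≻b′ , b′a′≡y , a′b′≡x))
      with b′ Fin.≟ a | b Fin.≟ a′ | b Fin.≟ b′
    ... | yes refl | _ | _ = ≻-asym a≻a′ a′≻b′
    -- Here b is a′, so the consecutive levels ψ a a′ and ψ a′ b′ both equal x.
    ... | no b′≢a | yes refl | _ = ¬increasing↻-repeat
      (subst₂ (λ u v → Increasing↻ u v (ψ b′ a)) ab≡x a′b′≡x (increasing (a≢a′ , b′≢a ∘ sym , a′≢b′)))
      where
      a′≢b′ : a′ ≢ b′
      a′≢b′ refl = ≻-irrefl a′≻b′
    -- With a common partner b, the triangle b a′ a has levels y, ψ a′ a, x, and y ≤ x forces ψ a′ a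
    -- strictly above y.
    ... | no b′≢a | no b≢a′ | yes refl = ℕ.≤⇒≯ p≤y (proj₁ (increasing↻-between y≤x
      (subst₂ (λ u v → Increasing↻ u (ψ a′ a) v) b′a′≡y ab≡x (increasing (b≢a′ , b′≢a , a≢a′ ∘ sym)))))
    -- The levels p, q, r, t belong to the closed walk a′ a b′ b a′. Each of four triangles combines
    -- two consecutive ones with a known value y or x, which gives p < q < r < t < p.
    ... | no b′≢a | no b≢a′ | no b≢b′ = ℕ.<-asym (ℕ.<-trans p<q q<r) (ℕ.<-trans r<t t<p)
      where
      a≢b : a ≢ b
      a≢b refl = ≻-irrefl a≻b
      a′≢b′ : a′ ≢ b′
      a′≢b′ refl = ≻-irrefl a′≻b′
      p = ψ a′ a
      q = ψ a b′
      r = ψ b′ b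
      t = ψ b a′
      p<q×q<y : p ℕ.< q × q ℕ.< y
      p<q×q<y = increasing↻-below p≤y
        (subst (λ u → Increasing↻ u p q) b′a′≡y (increasing (a′≢b′ ∘ sym , b′≢a , a≢a′ ∘ sym)))
      p<q = proj₁ p<q×q<y
      q<r×r<y : q ℕ.< r × r ℕ.< y
      q<r×r<y = increasing↻-below (ℕ.<⇒≤ (proj₂ p<q×q<y))
        (subst (λ u → Increasing↻ u q r) ba≡y (increasing (a≢b ∘ sym , b≢b′ , b′≢a ∘ sym)))
      q<r = proj₁ q<r×r<y
      r<t×t<x : r ℕ.< t × t ℕ.< x
      r<t×t<x = increasing↻-below (ℕ.≤-trans (ℕ.<⇒≤ (proj₂ q<r×r<y)) y≤x)
        (subst (λ u → Increasing↻ u r t) a′b′≡x (increasing (a′≢b′ , b≢a′ ∘ sym , b≢b′ ∘ sym)))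
      r<t = proj₁ r<t×t<x
      t<p : t ℕ.< p
      t<p = proj₁ (increasing↻-below (ℕ.<⇒≤ (proj₂ r<t×t<x))
        (subst (λ u → Increasing↻ u t p) ab≡x (increasing (a≢b , a≢a′ , b≢a′))))

  signature-unique : ∀ {a a′ y x} → Signature a y x → Signature a′ y x → a ≡ a′
  signature-unique {a} {a′} S S′ with a Fin.≟ a′
  ... | yes a≡a′ = a≡a′
  ... | no a≢a′ with ≻-total a≢a′
  ...   | inj₁ a≻a′ = contradiction a≻a′ (signature-clash S S′)
  ...   | inj₂ a′≻a = contradiction a′≻a (signature-clash S′ S)

  -- Signatures are coded by the staircase cells of rows 0 to B; two vertices with the same code
  -- would contradict `signature-unique`.
  vertices≤triangle : m ≤ triangle (suc B)
  vertices≤triangle with m ℕ.≤? triangle (suc B)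
  ... | yes m≤ = m≤
  ... | no m≰ with Fin.pigeonhole (ℕ.≰⇒> m≰) code
    where
    code : Fin m → Fin (triangle (suc B))
    code a = let (_ , _ , S) = signature a in
      fromℕ< (triangle-row (Signature.y≤x S) (s≤s (Signature.x≤B S)))
  ... | i , j , i<j , code≡ = contradiction i≡j (Fin.<⇒≢ i<j)
    where
    x-y : Fin m → ℕ
    x-y a = let (y , x , _) = signature a in triangle x + y
    xy≡ : x-y i ≡ x-y j
    xy≡ = trans (sym (Fin.toℕ-fromℕ< _)) (trans (cong toℕ code≡) (Fin.toℕ-fromℕ< _))
    i≡j : i ≡ j
    i≡j = let (y , x , S) = signature i ; (y′ , x′ , S′) = signature j
              (x≡x′ , y≡y′) = triangle-injective (Signature.y≤x S) (Signature.y≤x S′) xy≡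
          in signature-unique S (subst₂ (Signature j) (sym y≡y′) (sym x≡x′) S′)

-- The deletion method

sum-mono : ∀ {n} {f g : Fin n → ℕ} → (∀ i → f i ≤ g i) → sum f ≤ sum g
sum-mono {zero}  f≤g = z≤n
sum-mono {suc n} f≤g = ℕ.+-mono-≤ (f≤g zero) (sum-mono (f≤g ∘ suc))

sum-const : ∀ n c → sum {n} (λ _ → c) ≡ n * c
sum-const zero    c = refl
sum-const (suc n) c = cong (c ℕ.+_) (sum-const n c)

term≤sum : ∀ {n} (f : Fin n → ℕ) i → f i ≤ sum f
term≤sum f zero    = ℕ.m≤m+n (f zero) _
term≤sum f (suc i) = ℕ.≤-trans (term≤sum (f ∘ suc) i) (ℕ.m≤n+m _ (f zero))

minimiser : ∀ {n} (f : Fin (suc n) → ℕ) → ∃ λ i → ∀ j → f i ≤ f j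
minimiser {zero} f = zero , λ { zero → ℕ.≤-refl }
minimiser {suc n} f with minimiser (f ∘ suc)
... | i , min with ℕ.≤-total (f zero) (f (suc i))
...   | inj₁ f0≤fi = zero , λ { zero → ℕ.≤-refl ; (suc j) → ℕ.≤-trans f0≤fi (min j) }
...   | inj₂ fi≤f0 = suc i , λ { zero → fi≤f0 ; (suc j) → min j }

-- The first-moment principle with the denominator cleared: a minimum does not exceed the average.
∃-below-average : ∀ {n} .{{_ : ℕ.NonZero n}} (f : Fin n → ℕ) → ∃ λ i → n * f i ≤ sum f
∃-below-average {suc n} f with minimiser f
... | i , min = i , ℕ.≤-trans (ℕ.≤-reflexive (sym (sum-const (suc n) (f i)))) (sum-mono min)

-- Weights of lists and deletion

module _ {A : Set} where

  -- These three weights sum over increasing tuples of positions only, so an asymmetric weight has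
  -- to be symmetrised before its vanishing says anything about all orderings.
  weight₁ : (A → ℕ) → List A → ℕ
  weight₁ P []       = 0
  weight₁ P (x ∷ xs) = P x + weight₁ P xs

  weight₂ : (A → A → ℕ) → List A → ℕ
  weight₂ Q []       = 0
  weight₂ Q (x ∷ xs) = weight₁ (Q x) xs + weight₂ Q xs

  weight₃ : (A → A → A → ℕ) → List A → ℕ
  weight₃ E []       = 0
  weight₃ E (x ∷ xs) = weight₂ (E x) xs + weight₃ E xs

  -- Scan from the right and drop an element exactly when it forms a triple or pair of positive
  -- weight with elements already kept. Each drop is paid for by at least one unit of weight in
  -- which that element comes first.
  weightless-part : ∀ (E : A → A → A → ℕ) (Q : A → A → ℕ) xs → ∃ λ ys →
    weight₃ E ys ≡ 0 × weight₂ Q ys ≡ 0 × length xs ≤ length ys + (weight₃ E xs + weight₂ Q xs)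
  weightless-part E Q xs = let (ys , _ , _ , e , q , l) = go xs in ys , e , q , l
    where
    -- Domination for all weights `P` and `R` is what the induction uses of the fact that ys is a
    -- sublist of xs.
    go : ∀ xs → ∃ λ ys → (∀ P → weight₁ P ys ≤ weight₁ P xs) × (∀ R → weight₂ R ys ≤ weight₂ R xs) ×
         weight₃ E ys ≡ 0 × weight₂ Q ys ≡ 0 × length xs ≤ length ys + (weight₃ E xs + weight₂ Q xs)
    go [] = [] , (λ _ → z≤n) , (λ _ → z≤n) , refl , refl , z≤n
    go (x ∷ xs) with go xs
    ... | ys , m₁ , m₂ , e , q , l with weight₂ (E x) ys + weight₁ (Q x) ys in eq
    ...   | zero = x ∷ ys
      , (λ P → ℕ.+-monoʳ-≤ (P x) (m₁ P))
      , (λ R → ℕ.+-mono-≤ (m₁ (R x)) (m₂ R))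
      , cong₂ _+_ (ℕ.m+n≡0⇒m≡0 _ eq) e
      , cong₂ _+_ (ℕ.m+n≡0⇒n≡0 (weight₂ (E x) ys) eq) q
      , s≤s (ℕ.≤-trans l (ℕ.+-monoʳ-≤ (length ys)
          (ℕ.+-mono-≤ (ℕ.m≤n+m _ (weight₂ (E x) xs)) (ℕ.m≤n+m _ (weight₁ (Q x) xs)))))
    ...   | suc k = ys
      , (λ P → ℕ.≤-trans (m₁ P) (ℕ.m≤n+m _ (P x)))
      , (λ R → ℕ.≤-trans (m₂ R) (ℕ.m≤n+m _ (weight₁ (R x) xs)))
      , e , q
      , (begin
          suc (length xs)                     ≤⟨ ℕ.+-mono-≤ 1≤ l ⟩
          (u + v) + (length ys + (e′ + q′))   ≡⟨ +-*-Solver.solve 5 (λ u v l e q → (u :+ v) :+ (l :+ (e :+ q)) := l :+ ((u :+ e) :+ (v :+ q))) refl u v (length ys) e′ q′ ⟩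
          length ys + ((u + e′) + (v + q′))   ∎)
      where
      open ℕ.≤-Reasoning
      open +-*-Solver
      u = weight₂ (E x) xs
      v = weight₁ (Q x) xs
      e′ = weight₃ E xs
      q′ = weight₂ Q xs
      -- The conflict was found within ys; domination carries its weight over to xs.
      1≤ : 1 ≤ u + v
      1≤ = ℕ.≤-trans (ℕ.≤-trans (s≤s z≤n) (ℕ.≤-reflexive (sym eq))) (ℕ.+-mono-≤ (m₂ (E x)) (m₁ (Q x)))

  weight₁-lookup : ∀ P xs → weight₁ P xs ≡ 0 → ∀ i → P (lookup xs i) ≡ 0
  weight₁-lookup P (x ∷ xs) w≡0 zero    = ℕ.m+n≡0⇒m≡0 _ w≡0
  weight₁-lookup P (x ∷ xs) w≡0 (suc i) = weight₁-lookup P xs (ℕ.m+n≡0⇒n≡0 (P x) w≡0) i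

  weight₂-lookup : ∀ Q xs → weight₂ Q xs ≡ 0 →
                   ∀ {i j} → i Fin.< j → Q (lookup xs i) (lookup xs j) ≡ 0
  weight₂-lookup Q (x ∷ xs) w≡0 {zero}  {suc j} _ =
    weight₁-lookup (Q x) xs (ℕ.m+n≡0⇒m≡0 _ w≡0) j
  weight₂-lookup Q (x ∷ xs) w≡0 {suc i} {suc j} (s≤s i<j) =
    weight₂-lookup Q xs (ℕ.m+n≡0⇒n≡0 (weight₁ (Q x) xs) w≡0) i<j

  weight₃-lookup : ∀ E xs → weight₃ E xs ≡ 0 → ∀ {i j k} → i Fin.< j → j Fin.< k →
                   E (lookup xs i) (lookup xs j) (lookup xs k) ≡ 0
  weight₃-lookup E (x ∷ xs) w≡0 {zero}  {suc j} {suc k} _ (s≤s j<k) =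
    weight₂-lookup (E x) xs (ℕ.m+n≡0⇒m≡0 _ w≡0) j<k
  weight₃-lookup E (x ∷ xs) w≡0 {suc i} {suc j} {suc k} (s≤s i<j) (s≤s j<k) =
    weight₃-lookup E xs (ℕ.m+n≡0⇒n≡0 (weight₂ (E x) xs) w≡0) i<j j<k

-- The binomial coefficients k choose 2 and, in `triples`, k choose 3, defined by Pascal's rule to
-- match the recursion of the weights.
pairs : ℕ → ℕ
pairs zero    = 0
pairs (suc k) = k + pairs k

triples : ℕ → ℕ
triples zero    = 0
triples (suc k) = pairs k + triples k

pairs≤ : ∀ k → pairs k ≤ k * k
pairs≤ zero    = z≤n
pairs≤ (suc k) = begin
  k + pairs k           ≤⟨ ℕ.+-monoʳ-≤ k (pairs≤ k) ⟩
  k + k * k             ≤⟨ ℕ.+-mono-≤ (ℕ.n≤1+n k) (ℕ.*-monoʳ-≤ k (ℕ.n≤1+n k)) ⟩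
  suc k + k * suc k     ∎
  where open ℕ.≤-Reasoning

2*pairs : ∀ k → 2 * pairs k + k ≡ k * k
2*pairs zero    = refl
2*pairs (suc k) = begin
  2 * (k + pairs k) + suc k         ≡⟨ solve 2 (λ k p → con 2 :* (k :+ p) :+ (con 1 :+ k) := (con 2 :* p :+ k) :+ (con 1 :+ con 2 :* k)) refl k (pairs k) ⟩
  (2 * pairs k + k) + (1 + 2 * k)   ≡⟨ cong (_+ (1 + 2 * k)) (2*pairs k) ⟩
  k * k + (1 + 2 * k)               ≡⟨ solve 1 (λ k → k :* k :+ (con 1 :+ con 2 :* k) := (con 1 :+ k) :* (con 1 :+ k)) refl k ⟩
  suc k * suc k                     ∎
  where open ≡-Reasoning; open +-*-Solver

6*triples≤ : ∀ k → 6 * triples k ≤ k * k * k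
6*triples≤ zero    = z≤n
6*triples≤ (suc k) = begin
  6 * (pairs k + triples k)                   ≡⟨ solve 2 (λ p t → con 6 :* (p :+ t) := con 3 :* (con 2 :* p) :+ con 6 :* t) refl (pairs k) (triples k) ⟩
  3 * (2 * pairs k) + 6 * triples k           ≤⟨ ℕ.+-mono-≤ (ℕ.*-monoʳ-≤ 3 (ℕ.≤-trans (ℕ.m≤m+n _ k) (ℕ.≤-reflexive (2*pairs k)))) (6*triples≤ k) ⟩
  3 * (k * k) + k * k * k                     ≤⟨ ℕ.m≤m+n _ (3 * k + 1) ⟩
  3 * (k * k) + k * k * k + (3 * k + 1)       ≡⟨ solve 1 (λ k → con 3 :* (k :* k) :+ k :* k :* k :+ (con 3 :* k :+ con 1) := (con 1 :+ k) :* (con 1 :+ k) :* (con 1 :+ k)) refl k ⟩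
  suc k * suc k * suc k                       ∎
  where open ℕ.≤-Reasoning; open +-*-Solver

-- Averages over all lists of a given length

module _ {n : ℕ} where

  -- This is n ^ k times the expectation of F over k independent uniform samples, repetitions
  -- allowed.
  sumLists : ℕ → (List (Fin n) → ℕ) → ℕ
  sumLists zero    F = F []
  sumLists (suc k) F = sum λ x → sumLists k (F ∘ (x ∷_))

  sumLists-+ : ∀ k F G → sumLists k (λ xs → F xs + G xs) ≡ sumLists k F + sumLists k G
  sumLists-+ zero    F G = refl
  sumLists-+ (suc k) F G =
    trans (sum-cong-≗ (λ x → sumLists-+ k (F ∘ (x ∷_)) (G ∘ (x ∷_))))
          (∑-distrib-+ (λ x → sumLists k (F ∘ (x ∷_))) (λ x → sumLists k (G ∘ (x ∷_))))

  sumLists-const : ∀ k c → sumLists k (λ _ → c) ≡ n ^ k * c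
  sumLists-const zero    c = sym (ℕ.+-identityʳ c)
  sumLists-const (suc k) c = begin
    sum {n} (λ _ → sumLists k (λ _ → c))   ≡⟨ sum-const n _ ⟩
    n * sumLists k (λ _ → c)               ≡⟨ cong (n *_) (sumLists-const k c) ⟩
    n * (n ^ k * c)                        ≡⟨ ℕ.*-assoc n (n ^ k) c ⟨
    n ^ suc k * c                          ∎
    where open ≡-Reasoning

  sumLists-cons : ∀ k (f : Fin n → List (Fin n) → ℕ) g →
                  sum (λ x → sumLists k (λ xs → f x xs + g xs)) ≡
                  sum (λ x → sumLists k (f x)) + n * sumLists k g
  sumLists-cons k f g = begin
    sum (λ x → sumLists k (λ xs → f x xs + g xs))           ≡⟨ sum-cong-≗ (λ x → sumLists-+ k (f x) g) ⟩
    sum (λ x → sumLists k (f x) + sumLists k g)             ≡⟨ ∑-distrib-+ (λ x → sumLists k (f x)) _ ⟩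
    sum (λ x → sumLists k (f x)) + sum {n} (λ _ → sumLists k g)
      ≡⟨ cong (sum (λ x → sumLists k (f x)) ℕ.+_) (sum-const n _) ⟩
    sum (λ x → sumLists k (f x)) + n * sumLists k g         ∎
    where open ≡-Reasoning

  -- The entries are fixed one at a time, as in the method of conditional expectations.
  ∃-below-average-list : .{{_ : ℕ.NonZero n}} → ∀ k (F : List (Fin n) → ℕ) →
                         ∃ λ xs → length xs ≡ k × n ^ k * F xs ≤ sumLists k F
  ∃-below-average-list zero F = [] , refl , ℕ.≤-reflexive (ℕ.+-identityʳ (F []))
  ∃-below-average-list (suc k) F
    with x , x≤ ← ∃-below-average (λ x → sumLists k (F ∘ (x ∷_)))
    with xs , len , xs≤ ← ∃-below-average-list k (F ∘ (x ∷_))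
    = x ∷ xs , cong suc len , (begin
      n * n ^ k * F (x ∷ xs)           ≡⟨ ℕ.*-assoc n (n ^ k) _ ⟩
      n * (n ^ k * F (x ∷ xs))         ≤⟨ ℕ.*-monoʳ-≤ n xs≤ ⟩
      n * sumLists k (F ∘ (x ∷_))      ≤⟨ x≤ ⟩
      sumLists (suc k) F               ∎)
    where open ℕ.≤-Reasoning

  -- Linearity of expectation with denominators cleared: each of the k positions contributes the
  -- mean of P. The versions for pairs and triples reduce to the previous one by splitting off the
  -- first entry.
  sumLists-weight₁ : ∀ k P → n * sumLists k (weight₁ P) ≡ n ^ k * (k * sum P)
  sumLists-weight₁ zero P = trans (ℕ.*-zeroʳ n) refl
  sumLists-weight₁ (suc k) P = begin
    n * sum (λ x → sumLists k (λ xs → P x + weight₁ P xs))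
      ≡⟨ cong (n *_) (sumLists-cons k (λ x _ → P x) (weight₁ P)) ⟩
    n * (sum (λ x → sumLists k (λ _ → P x)) + n * s)
      ≡⟨ cong (λ z → n * (z + n * s))
           (trans (sum-cong-≗ λ x → sumLists-const k (P x)) (sym (*-distribˡ-sum (n ^ k) P))) ⟩
    n * (n ^ k * sum P + n * s)
      ≡⟨ cong (λ z → n * (n ^ k * sum P + z)) (sumLists-weight₁ k P) ⟩
    n * (n ^ k * sum P + n ^ k * (k * sum P))
      ≡⟨ solve 4 (λ n r k S → n :* (r :* S :+ r :* (k :* S)) := n :* r :* ((con 1 :+ k) :* S)) refl n (n ^ k) k (sum P) ⟩
    n ^ suc k * (suc k * sum P) ∎
    where
    open ≡-Reasoning
    open +-*-Solver
    s = sumLists k (weight₁ P)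

  sumLists-weight₂ : ∀ k Q → n * n * sumLists k (weight₂ Q) ≡ n ^ k * (pairs k * sum (sum ∘ Q))
  sumLists-weight₂ zero Q = ℕ.*-zeroʳ (n * n)
  sumLists-weight₂ (suc k) Q = begin
    n * n * sum (λ x → sumLists k (λ xs → weight₁ (Q x) xs + weight₂ Q xs))
      ≡⟨ cong (n * n *_) (sumLists-cons k (λ x → weight₁ (Q x)) (weight₂ Q)) ⟩
    n * n * (sum s₁ + n * s)
      ≡⟨ solve 3 (λ n a s → n :* n :* (a :+ n :* s) := n :* (n :* a) :+ n :* (n :* n :* s)) refl n (sum s₁) s ⟩
    n * (n * sum s₁) + n * (n * n * s)
      ≡⟨ cong₂ (λ u v → n * u + n * v)
           (trans (*-distribˡ-sum n s₁) (trans (sum-cong-≗ λ x → trans (sumLists-weight₁ k (Q x)) (sym (ℕ.*-assoc (n ^ k) k _)))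
                  (sym (*-distribˡ-sum (n ^ k * k) (sum ∘ Q)))))
           (sumLists-weight₂ k Q) ⟩
    n * (n ^ k * k * sum (sum ∘ Q)) + n * (n ^ k * (pairs k * sum (sum ∘ Q)))
      ≡⟨ solve 5 (λ n r k p S → n :* (r :* k :* S) :+ n :* (r :* (p :* S)) := n :* r :* ((k :+ p) :* S)) refl n (n ^ k) k (pairs k) (sum (sum ∘ Q)) ⟩
    n ^ suc k * (pairs (suc k) * sum (sum ∘ Q)) ∎
    where
    open ≡-Reasoning
    open +-*-Solver
    s = sumLists k (weight₂ Q)
    s₁ : Fin n → ℕ
    s₁ x = sumLists k (weight₁ (Q x))

  sum₃ : (Fin n → Fin n → Fin n → ℕ) → ℕ
  sum₃ E = sum λ x → sum λ y → sum λ z → E x y z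

  sumLists-weight₃ : ∀ k E → n * n * n * sumLists k (weight₃ E) ≡ n ^ k * (triples k * sum₃ E)
  sumLists-weight₃ zero E = ℕ.*-zeroʳ (n * n * n)
  sumLists-weight₃ (suc k) E = begin
    n * n * n * sum (λ x → sumLists k (λ xs → weight₂ (E x) xs + weight₃ E xs))
      ≡⟨ cong (n * n * n *_) (sumLists-cons k (λ x → weight₂ (E x)) (weight₃ E)) ⟩
    n * n * n * (sum s₂ + n * s)
      ≡⟨ solve 3 (λ n a s → n :* n :* n :* (a :+ n :* s) := n :* (n :* n :* a) :+ n :* (n :* n :* n :* s)) refl n (sum s₂) s ⟩
    n * (n * n * sum s₂) + n * (n * n * n * s)
      ≡⟨ cong₂ (λ u v → n * u + n * v)
           (trans (*-distribˡ-sum (n * n) s₂) (trans (sum-cong-≗ λ x → trans (sumLists-weight₂ k (E x)) (sym (ℕ.*-assoc (n ^ k) (pairs k) _)))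
                  (sym (*-distribˡ-sum (n ^ k * pairs k) (λ x → sum (sum ∘ E x))))))
           (sumLists-weight₃ k E) ⟩
    n * (n ^ k * pairs k * sum₃ E) + n * (n ^ k * (triples k * sum₃ E))
      ≡⟨ solve 5 (λ n r p t S → n :* (r :* p :* S) :+ n :* (r :* (t :* S)) := n :* r :* ((p :+ t) :* S)) refl n (n ^ k) (pairs k) (triples k) (sum₃ E) ⟩
    n ^ suc k * (triples (suc k) * sum₃ E) ∎
    where
    open ≡-Reasoning
    open +-*-Solver
    s = sumLists k (weight₃ E)
    s₂ : Fin n → ℕ
    s₂ x = sumLists k (weight₂ (E x))

-- Kronecker's delta; as a weight on pairs it charges the repeated entries of a sampled list.
δ : ∀ {n} → Fin n → Fin n → ℕ
δ zero    zero    = 1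
δ zero    (suc _) = 0
δ (suc _) zero    = 0
δ (suc x) (suc y) = δ x y

δ-refl : ∀ {n} (x : Fin n) → δ x x ≡ 1
δ-refl zero    = refl
δ-refl (suc x) = δ-refl x

sum-δ : ∀ {n} (x : Fin n) → sum (δ x) ≡ 1
sum-δ {suc n} zero = cong suc (trans (sum-const n 0) (ℕ.*-zeroʳ n))
sum-δ (suc x)      = sum-δ x

-- Symmetrised weights and avoiding lists

module _ {n : ℕ} where

  sum₃-+ : ∀ (D E : Fin n → Fin n → Fin n → ℕ) →
           sum₃ (λ x y z → D x y z + E x y z) ≡ sum₃ D + sum₃ E
  sum₃-+ D E = trans
    (sum-cong-≗ λ x → trans (sum-cong-≗ λ y → ∑-distrib-+ (D x y) (E x y)) (∑-distrib-+ (sum ∘ D x) (sum ∘ E x)))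
    (∑-distrib-+ (λ x → sum (sum ∘ D x)) (λ x → sum (sum ∘ E x)))

  rotate swap : (Fin n → Fin n → Fin n → ℕ) → Fin n → Fin n → Fin n → ℕ
  rotate E x y z = E y z x
  swap   E x y z = E y x z

  sum₃-swap : ∀ E → sum₃ (swap E) ≡ sum₃ E
  sum₃-swap E = sym (∑-comm λ x y → sum (E x y))

  sum₃-rotate : ∀ E → sum₃ (rotate E) ≡ sum₃ E
  sum₃-rotate E = trans (∑-comm λ x y → sum λ z → E y z x)
                        (sum-cong-≗ λ y → ∑-comm λ x z → E y z x)

  -- `symmetrise E` adds E over all six orderings, the three rotations of each orientation, so it
  -- vanishes only if E vanishes on every ordering.
  cyclicSum symmetrise : (Fin n → Fin n → Fin n → ℕ) → Fin n → Fin n → Fin n → ℕ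
  cyclicSum E x y z = E x y z + (rotate E x y z + rotate (rotate E) x y z)
  symmetrise E x y z = cyclicSum E x y z + cyclicSum (swap E) x y z

  sum₃-cyclicSum : ∀ E → sum₃ (cyclicSum E) ≡ 3 * sum₃ E
  sum₃-cyclicSum E = begin
    sum₃ (cyclicSum E)                                          ≡⟨ sum₃-+ E (λ x y z → rotate E x y z + rotate (rotate E) x y z) ⟩
    sum₃ E + sum₃ (λ x y z → rotate E x y z + rotate (rotate E) x y z)
      ≡⟨ cong (sum₃ E ℕ.+_) (sum₃-+ (rotate E) (rotate (rotate E))) ⟩
    sum₃ E + (sum₃ (rotate E) + sum₃ (rotate (rotate E)))
      ≡⟨ cong (sum₃ E ℕ.+_) (cong₂ _+_ (sum₃-rotate E) (trans (sum₃-rotate (rotate E)) (trans (sum₃-rotate E) (sym (ℕ.+-identityʳ _))))) ⟩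
    3 * sum₃ E ∎
    where open ≡-Reasoning

  sum₃-symmetrise : ∀ E → sum₃ (symmetrise E) ≡ 6 * sum₃ E
  sum₃-symmetrise E = begin
    sum₃ (symmetrise E)                                  ≡⟨ sum₃-+ (cyclicSum E) (cyclicSum (swap E)) ⟩
    sum₃ (cyclicSum E) + sum₃ (cyclicSum (swap E))       ≡⟨ cong₂ _+_ (sum₃-cyclicSum E) (sum₃-cyclicSum (swap E)) ⟩
    3 * sum₃ E + 3 * sum₃ (swap E)                       ≡⟨ cong (λ u → 3 * sum₃ E + 3 * u) (sum₃-swap E) ⟩
    3 * sum₃ E + 3 * sum₃ E                              ≡⟨ ℕ.*-distribʳ-+ (sum₃ E) 3 3 ⟨
    6 * sum₃ E                                           ∎
    where open ≡-Reasoning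

  sum₃≤ : ∀ E t → (∀ x y → sum (E x y) ≤ t) → sum₃ E ≤ n * (n * t)
  sum₃≤ E t E≤ = begin
    sum₃ E                                ≤⟨ sum-mono {n} (λ x → sum-mono {n} (E≤ x)) ⟩
    sum {n} (λ x → sum {n} λ y → t)       ≡⟨ trans (sum-cong-≗ {n} λ _ → sum-const n t) (sum-const n (n * t)) ⟩
    n * (n * t)                           ∎
    where open ℕ.≤-Reasoning

  AvoidsOn : (Fin n → Fin n → Fin n → ℕ) → List (Fin n) → Set
  AvoidsOn E ys = ∀ {i j k} → Distinct i j k → E (lookup ys i) (lookup ys j) (lookup ys k) ≡ 0

  cyclicSum≡0 : ∀ E {x y z} → cyclicSum E x y z ≡ 0 → E x y z ≡ 0 × E y z x ≡ 0 × E z x y ≡ 0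
  cyclicSum≡0 E {x} {y} {z} eq =
      ℕ.m+n≡0⇒m≡0 _ eq
    , ℕ.m+n≡0⇒m≡0 _ (ℕ.m+n≡0⇒n≡0 (E x y z) eq)
    , ℕ.m+n≡0⇒n≡0 (E y z x) (ℕ.m+n≡0⇒n≡0 (E x y z) eq)

  symmetrise≡0 : ∀ E {x y z} → symmetrise E x y z ≡ 0 →
                 (E x y z ≡ 0 × E y z x ≡ 0 × E z x y ≡ 0) × (E y x z ≡ 0 × E z y x ≡ 0 × E x z y ≡ 0)
  symmetrise≡0 E {x} {y} {z} eq =
      cyclicSum≡0 E (ℕ.m+n≡0⇒m≡0 _ eq)
    , cyclicSum≡0 (swap E) (ℕ.m+n≡0⇒n≡0 (cyclicSum E x y z) eq)

  -- Sort the three positions: the required value of E is one of the six summands at the sorted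
  -- triple.
  symmetrise-avoids : ∀ E ys → weight₃ (symmetrise E) ys ≡ 0 → AvoidsOn E ys
  symmetrise-avoids E ys w≡0 {i} {j} {k} (i≢j , i≢k , j≢k) =
    by-order (Fin.<-cmp i j) (Fin.<-cmp i k) (Fin.<-cmp j k)
    where
    sorted : ∀ {a b c} → a Fin.< b → b Fin.< c → _
    sorted a<b b<c = symmetrise≡0 E (weight₃-lookup (symmetrise E) ys w≡0 a<b b<c)

    Comparison : Fin (length ys) → Fin (length ys) → Set
    Comparison a b = Tri (a Fin.< b) (a ≡ b) (b Fin.< a)

    by-order : Comparison i j → Comparison i k → Comparison j k →
               E (lookup ys i) (lookup ys j) (lookup ys k) ≡ 0
    by-order (tri≈ _ i≡j _) _ _ = contradiction i≡j i≢j
    by-order _ (tri≈ _ i≡k _) _ = contradiction i≡k i≢k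
    by-order _ _ (tri≈ _ j≡k _) = contradiction j≡k j≢k
    by-order (tri< i<j _ _) _ (tri< j<k _ _) = proj₁ (proj₁ (sorted i<j j<k))
    by-order (tri< _ _ _) (tri< i<k _ _) (tri> _ _ k<j) = proj₂ (proj₂ (proj₂ (sorted i<k k<j)))
    by-order (tri< i<j _ _) (tri> _ _ k<i) (tri> _ _ _) = proj₁ (proj₂ (proj₁ (sorted k<i i<j)))
    by-order (tri> _ _ j<i) (tri< i<k _ _) (tri< _ _ _) = proj₁ (proj₂ (sorted j<i i<k))
    by-order (tri> _ _ _) (tri> _ _ k<i) (tri< j<k _ _) = proj₂ (proj₂ (proj₁ (sorted j<k k<i)))
    by-order (tri> _ _ j<i) _ (tri> _ _ k<j) = proj₁ (proj₂ (proj₂ (sorted k<j j<i)))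

  δ-distinct : ∀ (ys : List (Fin n)) → weight₂ δ ys ≡ 0 → ∀ {i j} → i ≢ j → lookup ys i ≢ lookup ys j
  δ-distinct ys w≡0 {i} {j} i≢j eq with Fin.<-cmp i j
  ... | tri≈ _ i≡j _ = i≢j i≡j
  ... | tri< i<j _ _ = contradiction (trans (sym (δ-refl (lookup ys j))) (trans (cong (λ x → δ x (lookup ys j)) (sym eq)) (weight₂-lookup δ ys w≡0 i<j))) λ ()
  ... | tri> _ _ j<i = contradiction (trans (sym (δ-refl (lookup ys j))) (trans (cong (δ (lookup ys j)) (sym eq)) (weight₂-lookup δ ys w≡0 j<i))) λ ()

  -- Deletion method: a random list of k vertices is expected to have at most
  -- (k³ t + k²) / n coincidences, weighted by E.
  ∃-avoiding : .{{_ : ℕ.NonZero n}} → ∀ E t → (∀ x y → sum (E x y) ≤ t) → ∀ k → ∃ λ ys →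
               (∀ {i j} → i ≢ j → lookup ys i ≢ lookup ys j) × AvoidsOn E ys ×
               n * k ≤ n * length ys + (k * k * k * t + k * k)
  ∃-avoiding E t E≤ k
    with xs , refl , avg ← ∃-below-average-list k (λ xs → weight₃ (symmetrise E) xs + weight₂ δ xs)
    with ys , w₃ , w₂ , len ← weightless-part (symmetrise E) δ xs
    = ys , δ-distinct ys w₂ , symmetrise-avoids E ys w₃ , (begin
      n * k                             ≤⟨ ℕ.*-monoʳ-≤ n len ⟩
      n * (length ys + cost)            ≡⟨ ℕ.*-distribˡ-+ n (length ys) cost ⟩
      n * length ys + n * cost          ≤⟨ ℕ.+-monoʳ-≤ (n * length ys) n*cost≤ ⟩
      n * length ys + (k * k * k * t + k * k) ∎)
    where
    open ℕ.≤-Reasoning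
    open +-*-Solver
    instance _ = ℕ.m^n≢0 n k
             _ = ℕ.m*n≢0 n n
             _ = ℕ.m*n≢0 (n * n) (n ^ k)
    cost = weight₃ (symmetrise E) xs + weight₂ δ xs
    S₃ = sumLists k (weight₃ (symmetrise E))
    S₂ = sumLists k (weight₂ δ)

    -- The factor 6 from symmetrising is absorbed by the 3! in the binomial coefficient, leaving k³.
    n*n*n*S₃≤ : n * n * n * S₃ ≤ n ^ k * (k * k * k * (n * (n * t)))
    n*n*n*S₃≤ = begin
      n * n * n * S₃                                  ≡⟨ sumLists-weight₃ k (symmetrise E) ⟩
      n ^ k * (triples k * sum₃ (symmetrise E))       ≡⟨ cong (λ u → n ^ k * (triples k * u)) (sum₃-symmetrise E) ⟩
      n ^ k * (triples k * (6 * sum₃ E))              ≡⟨ cong (n ^ k *_) (solve 2 (λ p s → p :* (con 6 :* s) := con 6 :* p :* s) refl (triples k) (sum₃ E)) ⟩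
      n ^ k * (6 * triples k * sum₃ E)                ≤⟨ ℕ.*-monoʳ-≤ (n ^ k) (ℕ.*-mono-≤ (6*triples≤ k) (sum₃≤ E t E≤)) ⟩
      n ^ k * (k * k * k * (n * (n * t)))             ∎

    n*n*S₂≤ : n * n * S₂ ≤ n ^ k * (k * k * n)
    n*n*S₂≤ = begin
      n * n * S₂                              ≡⟨ sumLists-weight₂ k δ ⟩
      n ^ k * (pairs k * sum {n} (sum ∘ δ))   ≡⟨ cong (λ u → n ^ k * (pairs k * u)) (trans (sum-cong-≗ {n} sum-δ) (trans (sum-const n 1) (ℕ.*-identityʳ n))) ⟩
      n ^ k * (pairs k * n)                   ≤⟨ ℕ.*-monoʳ-≤ (n ^ k) (ℕ.*-monoˡ-≤ n (pairs≤ k)) ⟩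
      n ^ k * (k * k * n)                     ∎

    n*cost≤ : n * cost ≤ k * k * k * t + k * k
    n*cost≤ = ℕ.*-cancelˡ-≤ (n * n * n ^ k) (begin
      n * n * n ^ k * (n * cost)        ≡⟨ solve 3 (λ n r c → n :* n :* r :* (n :* c) := n :* n :* n :* (r :* c)) refl n (n ^ k) cost ⟩
      n * n * n * (n ^ k * cost)        ≤⟨ ℕ.*-monoʳ-≤ (n * n * n) avg ⟩
      n * n * n * sumLists k (λ xs → weight₃ (symmetrise E) xs + weight₂ δ xs)
                                        ≡⟨ cong (n * n * n *_) (sumLists-+ k (weight₃ (symmetrise E)) (weight₂ δ)) ⟩
      n * n * n * (S₃ + S₂)             ≡⟨ solve 3 (λ n a b → n :* n :* n :* (a :+ b) := n :* n :* n :* a :+ n :* (n :* n :* b)) refl n S₃ S₂ ⟩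
      n * n * n * S₃ + n * (n * n * S₂) ≤⟨ ℕ.+-mono-≤ n*n*n*S₃≤ (ℕ.*-monoʳ-≤ n n*n*S₂≤) ⟩
      n ^ k * (k * k * k * (n * (n * t))) + n * (n ^ k * (k * k * n))
                                        ≡⟨ solve 4 (λ n r k t → r :* (k :* k :* k :* (n :* (n :* t))) :+ n :* (r :* (k :* k :* n)) := n :* n :* r :* (k :* k :* k :* t :+ k :* k)) refl n (n ^ k) k t ⟩
      n * n * n ^ k * (k * k * k * t + k * k) ∎)

-- Levels of pairs in a tournament

bit : Bool → ℕ
bit true  = 1
bit false = 0

length-filterᵇ-∷ : ∀ {A : Set} (p : A → Bool) x xs → length (filterᵇ p (x ∷ xs)) ≡ bit (p x) + length (filterᵇ p xs)
length-filterᵇ-∷ p x xs with p x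
... | true  = refl
... | false = refl

#edgesOn-cyclic : ∀ {n} (G : Digraph₃ n) a b c → #edgesOn G a b c ≡
  (bit (edge G a b c) + bit (edge G b c a) + bit (edge G c a b)) +
  (bit (edge G a c b) + bit (edge G c b a) + bit (edge G b a c))
#edgesOn-cyclic G a b c
  rewrite length-filterᵇ-∷ (edgeAt G) (a , b , c) ((a , c , b) ∷ (b , a , c) ∷ (b , c , a) ∷ (c , a , b) ∷ (c , b , a) ∷ [])
        | length-filterᵇ-∷ (edgeAt G) (a , c , b) ((b , a , c) ∷ (b , c , a) ∷ (c , a , b) ∷ (c , b , a) ∷ [])
        | length-filterᵇ-∷ (edgeAt G) (b , a , c) ((b , c , a) ∷ (c , a , b) ∷ (c , b , a) ∷ [])
        | length-filterᵇ-∷ (edgeAt G) (b , c , a) ((c , a , b) ∷ (c , b , a) ∷ [])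
        | length-filterᵇ-∷ (edgeAt G) (c , a , b) ((c , b , a) ∷ [])
        | length-filterᵇ-∷ (edgeAt G) (c , b , a) [] =
  solve 6 (λ u v w x y z → u :+ (v :+ (w :+ (x :+ (y :+ (z :+ con 0))))) := (u :+ x :+ y) :+ (v :+ z :+ w)) refl
    (bit (edge G a b c)) (bit (edge G a c b)) (bit (edge G b a c))
    (bit (edge G b c a)) (bit (edge G c a b)) (bit (edge G c b a))
  where open +-*-Solver

not-all⇒≤2 : ∀ p q r → ¬ (T p × T q × T r) → bit p + bit q + bit r ≤ 2
not-all⇒≤2 true  true  true  h = contradiction _ h
not-all⇒≤2 true  true  false _ = ℕ.≤-refl
not-all⇒≤2 true  false true  _ = ℕ.≤-refl
not-all⇒≤2 true  false false _ = s≤s z≤n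
not-all⇒≤2 false true  true  _ = ℕ.≤-refl
not-all⇒≤2 false true  false _ = s≤s z≤n
not-all⇒≤2 false false true  _ = s≤s z≤n
not-all⇒≤2 false false false _ = z≤n

two-of-three : ∀ p q r → 2 ≤ bit p + bit q + bit r → (T p × T q) ⊎ (T q × T r) ⊎ (T r × T p)
two-of-three true  true  _     _ = inj₁ _
two-of-three true  false true  _ = inj₂ (inj₂ _)
two-of-three false true  true  _ = inj₂ (inj₁ _)
two-of-three true  false false (s≤s ())
two-of-three false true  false (s≤s ())
two-of-three false false true  (s≤s ())
two-of-three false false false ()

-- An orientation that lacks an edge carries at most two of the four, so the opposite one carries at
-- least two. Any two of three rotations are consecutive and hence share an ordered pair, along
-- which levels can be compared.
two-cyclic-edges : ∀ {n} (G : Digraph₃ n) → IsTournament₃ 4 G → ∀ {a b c} → Distinct a b c →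
  ¬ (T (edge G a c b) × T (edge G c b a) × T (edge G b a c)) →
  (T (edge G a b c) × T (edge G b c a)) ⊎ (T (edge G b c a) × T (edge G c a b)) ⊎ (T (edge G c a b) × T (edge G a b c))
two-cyclic-edges G tour {a} {b} {c} d not-all = two-of-three _ _ _
  (ℕ.+-cancelʳ-≤ 2 2 _ (begin
    4                ≡⟨ tour a b c d ⟨
    #edgesOn G a b c ≡⟨ #edgesOn-cyclic G a b c ⟩
    _                ≤⟨ ℕ.+-monoʳ-≤ (bit (edge G a b c) + bit (edge G b c a) + bit (edge G c a b)) (not-all⇒≤2 _ _ _ not-all) ⟩
    _                ∎))
  where open ℕ.≤-Reasoning

largest≤-≤ : {P : ℕ → Set} (P? : ∀ s → Dec (P s)) → ∀ b → largest≤ P? b ≤ b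
largest≤-≤ P? zero = z≤n
largest≤-≤ P? (suc b) with P? (suc b)
... | yes _ = ℕ.≤-refl
... | no  _ = ℕ.m≤n⇒m≤1+n (largest≤-≤ P? b)

∷-isCopy : ∀ {n m} (G : Digraph₃ n) a (p : Fin (2 + m) → Fin n) → IsCopy G (tightPath (2 + m)) p →
           (∀ i → p i ≢ a) → T (edge G a (p zero) (p (suc zero))) → IsCopy G (tightPath (3 + m)) (a ◂ p)
∷-isCopy {n} {m} G a p (inj , hom) a∉p e = inj′ , hom′
  where
  inj′ : ∀ {i j} → (a ◂ p) i ≡ (a ◂ p) j → i ≡ j
  inj′ {zero}  {zero}  _  = refl
  inj′ {zero}  {suc j} eq = contradiction (sym eq) (a∉p j)
  inj′ {suc i} {zero}  eq = contradiction eq (a∉p i)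
  inj′ {suc i} {suc j} eq = cong suc (inj eq)

  hom′ : ∀ i j k → T (edge (tightPath (3 + m)) i j k) → T (edge G ((a ◂ p) i) ((a ◂ p) j) ((a ◂ p) k))
  hom′ i j zero t = contradiction (proj₂ (Equivalence.to T-∧ t)) id
  hom′ zero zero (suc k) ()
  hom′ zero (suc zero) (suc zero) ()
  hom′ zero (suc zero) (suc (suc zero)) _ = e
  hom′ zero (suc zero) (suc (suc (suc k))) ()
  hom′ zero (suc (suc j)) (suc k) ()
  hom′ (suc i) zero (suc k) ()
  hom′ (suc i) (suc j) (suc k) t = hom i j k t

-- Longest tight paths and the cyclic order of their levels

module LongestPaths {n : ℕ} (G : Digraph₃ n) where

  PathFrom : Fin n → Fin n → ℕ → Set
  PathFrom a b k = ∃ λ (p : Fin (2 + k) → Fin n) → IsCopy G (tightPath (2 + k)) p × p zero ≡ a × p (suc zero) ≡ b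

  pathFrom? : ∀ a b k → Dec (PathFrom a b k)
  pathFrom? a b k = anyFunction?
    (λ φ≗ψ (copy , p₀ , p₁) → isCopy-resp G (tightPath (2 + k)) φ≗ψ copy
                            , trans (sym (φ≗ψ zero)) p₀ , trans (sym (φ≗ψ (suc zero))) p₁)
    (λ p → isCopy? G (tightPath (2 + k)) p ×-dec (p zero Fin.≟ a) ×-dec (p (suc zero) Fin.≟ b))

  -- Level k means a tight path on k + 1 vertices. Level 0 always holds, which gives the search a
  -- base and also covers the pairs with a ≡ b.
  HasLevel : Fin n → Fin n → ℕ → Set
  HasLevel a b zero    = ⊤
  HasLevel a b (suc k) = PathFrom a b k

  hasLevel? : ∀ a b k → Dec (HasLevel a b k)
  hasLevel? a b zero    = yes tt
  hasLevel? a b (suc k) = pathFrom? a b k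

  hasLevel₁ : ∀ {a b} → a ≢ b → HasLevel a b 1
  hasLevel₁ {a} {b} a≢b = p , (inj , hom) , refl , refl
    where
    p : Fin 2 → Fin n
    p zero       = a
    p (suc zero) = b
    inj : ∀ {i j} → p i ≡ p j → i ≡ j
    inj {zero}     {zero}     _  = refl
    inj {zero}     {suc zero} eq = contradiction eq a≢b
    inj {suc zero} {zero}     eq = contradiction (sym eq) a≢b
    inj {suc zero} {suc zero} _  = refl
    hom : ∀ i j k → T (edge (tightPath 2) i j k) → T (edge G (p i) (p j) (p k))
    hom i          j          zero       t = contradiction (proj₂ (Equivalence.to T-∧ t)) id
    hom zero       zero       (suc zero) ()
    hom zero       (suc zero) (suc zero) ()
    hom (suc zero) zero       (suc zero) ()
    hom (suc zero) (suc zero) (suc zero) ()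

  -- The indicator of the path's vertex set, written as a sum of deltas so that it can serve as a
  -- weight in the deletion method.
  visits : ∀ {a b k} → HasLevel a b k → Fin n → ℕ
  visits {k = zero}  _       z = 0
  visits {k = suc k} (p , _) z = sum λ i → δ (p i) z

  sum-visits≤ : ∀ {a b k} (h : HasLevel a b k) → sum (visits {a} {b} {k} h) ≤ suc k
  sum-visits≤ {k = zero} _ = ℕ.≤-trans (ℕ.≤-reflexive (trans (sum-const n 0) (ℕ.*-zeroʳ n))) z≤n
  sum-visits≤ {k = suc k} (p , _) = ℕ.≤-reflexive (begin
    sum (λ z → sum (λ i → δ (p i) z))     ≡⟨ ∑-comm (λ z i → δ (p i) z) ⟩
    sum (λ i → sum (δ (p i)))             ≡⟨ sum-cong-≗ (λ i → sum-δ (p i)) ⟩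
    sum {2 + k} (λ i → 1)                 ≡⟨ trans (sum-const (2 + k) 1) (ℕ.*-identityʳ (2 + k)) ⟩
    2 + k                                 ∎)
    where open ≡-Reasoning

  hasLevel-∷ : ∀ {a b c k} (h : HasLevel b c (suc k)) → visits {b} {c} {suc k} h a ≡ 0 →
               T (edge G a b c) → HasLevel a b (suc (suc k))
  hasLevel-∷ {a} (p , copy , refl , refl) v≡0 e = a ◂ p , ∷-isCopy G a p copy a∉p e , refl , refl
    where
    a∉p : ∀ i → p i ≢ a
    a∉p i pi≡a = contradiction
      (ℕ.≤-trans (ℕ.≤-reflexive (sym (trans (cong (λ x → δ x a) pi≡a) (δ-refl a))))
                 (ℕ.≤-trans (term≤sum (λ i → δ (p i) a) i) (ℕ.≤-reflexive v≡0)))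
      λ ()

  module _ {B : ℕ} (no-path : ¬ Contains G (tightPath (2 + B))) where

    level : Fin n → Fin n → ℕ
    level a b = largest≤ (hasLevel? a b) B

    level≤B : ∀ a b → level a b ≤ B
    level≤B a b = largest≤-≤ (hasLevel? a b) B

    level-witness : ∀ a b → HasLevel a b (level a b)
    level-witness a b = largest≤-sat (hasLevel? a b) tt B

    -- The search for `level` stops at B, but k = B + 1 is admissible too: it would be the excluded
    -- path on B + 2 vertices.
    level-maximal : ∀ {a b k} → k ≤ suc B → HasLevel a b k → k ≤ level a b
    level-maximal {a} {b} {k} k≤1+B h with ℕ.m≤n⇒m<n∨m≡n k≤1+B
    ... | inj₁ (s≤s k≤B) = largest≤-max (hasLevel? a b) B k k≤B h
    ... | inj₂ refl      = contradiction (proj₁ h , proj₁ (proj₂ h)) no-path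

    level>0 : ∀ {a b} → a ≢ b → 0 ℕ.< level a b
    level>0 a≢b = level-maximal (s≤s z≤n) (hasLevel₁ a≢b)

    -- Charges a triple b, c, a when a lies on the chosen longest path from (b , c). With a last,
    -- each inner sum counts the vertices of one path.
    blocking : Fin n → Fin n → Fin n → ℕ
    blocking b c = visits {b} {c} {level b c} (level-witness b c)

    sum-blocking≤ : ∀ b c → sum (blocking b c) ≤ suc B
    sum-blocking≤ b c = ℕ.≤-trans (sum-visits≤ {b} {c} {level b c} (level-witness b c)) (s≤s (level≤B b c))

    level-decreasing : ∀ {a b c} → blocking b c a ≡ 0 → T (edge G a b c) → level b c ℕ.< level a b
    level-decreasing {a} {b} {c} unblocked e =
      go (level b c) (level-witness b c) (level>0 (proj₂ (proj₂ (edge⇒distinct G e)))) (level≤B b c) unblocked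
      where
      -- The level becomes a variable, so that a positive value exposes the path to which a is
      -- prepended.
      go : ∀ k (h : HasLevel b c k) → 0 ℕ.< k → k ≤ B → visits {b} {c} {k} h a ≡ 0 → k ℕ.< level a b
      go (suc k) h _ k≤B v≡0 = level-maximal (s≤s k≤B) (hasLevel-∷ {a} {b} {c} {k} h v≡0 e)

    module _ (tour : IsTournament₃ 4 G) (ys : List (Fin n))
             (ys-distinct : ∀ {i j} → i ≢ j → lookup ys i ≢ lookup ys j)
             (unblocked : AvoidsOn blocking ys)
      where

      decreasing : ∀ {i j k} → Distinct i j k → T (edge G (lookup ys i) (lookup ys j) (lookup ys k)) →
                   level (lookup ys j) (lookup ys k) ℕ.< level (lookup ys i) (lookup ys j)
      decreasing (i≢j , i≢k , j≢k) = level-decreasing (unblocked (j≢k , i≢j ∘ sym , i≢k ∘ sym))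

      -- Three edges oriented i j k would make the level drop strictly all the way round, so the
      -- orientation i k j has two consecutive edges. Their two drops order the three levels;
      -- reversing each pair turns descent into ascent.
      level-increasing↻ : ∀ {i j k} → Distinct i j k → Increasing↻
        (level (lookup ys j) (lookup ys i)) (level (lookup ys k) (lookup ys j)) (level (lookup ys i) (lookup ys k))
      level-increasing↻ {i} {j} {k} (i≢j , i≢k , j≢k)
        with two-cyclic-edges G tour (ys-distinct i≢k , ys-distinct i≢j , ys-distinct (j≢k ∘ sym))
          (λ (ijk , jki , kij) → ℕ.<-irrefl refl (ℕ.<-trans (decreasing kij-d kij)
            (ℕ.<-trans (decreasing jki-d jki) (decreasing ijk-d ijk))))
        where
        ijk-d : Distinct i j k
        ijk-d = i≢j , i≢k , j≢k
        jki-d : Distinct j k i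
        jki-d = j≢k , i≢j ∘ sym , i≢k ∘ sym
        kij-d : Distinct k i j
        kij-d = i≢k ∘ sym , j≢k ∘ sym , i≢j
      ... | inj₁ (ikj , kji)        = inj₁ (decreasing kji-d kji , decreasing ikj-d ikj)
        where
        ikj-d : Distinct i k j
        ikj-d = i≢k , i≢j , j≢k ∘ sym
        kji-d : Distinct k j i
        kji-d = j≢k ∘ sym , i≢k ∘ sym , i≢j ∘ sym
      ... | inj₂ (inj₁ (kji , jik)) = inj₂ (inj₂ (decreasing jik-d jik , decreasing kji-d kji))
        where
        jik-d : Distinct j i k
        jik-d = i≢j ∘ sym , j≢k , i≢k
        kji-d : Distinct k j i
        kji-d = j≢k ∘ sym , i≢k ∘ sym , i≢j ∘ sym
      ... | inj₂ (inj₂ (jik , ikj)) = inj₂ (inj₁ (decreasing ikj-d ikj , decreasing jik-d jik))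
        where
        ikj-d : Distinct i k j
        ikj-d = i≢k , i≢j , j≢k ∘ sym
        jik-d : Distinct j i k
        jik-d = i≢j ∘ sym , j≢k , i≢k

      length≤triangle : length ys ≤ triangle (suc B)
      length≤triangle = CyclicLevels.vertices≤triangle
        (λ i j → level (lookup ys j) (lookup ys i))
        (λ i j → level≤B (lookup ys j) (lookup ys i))
        (λ i≢j → level>0 (ys-distinct (i≢j ∘ sym)))
        level-increasing↻

    few-vertices : IsTournament₃ 4 G → ¬ 3 * (2 + B) ^ 5 ≤ n
    few-vertices tour 3s⁵≤n = ℕ.<⇒≱ too-short (ℕ.*-cancelˡ-≤ n {{n≢0}} too-long)
      where
      open ℕ.≤-Reasoning
      open +-*-Solver
      s = 2 + B
      -- With s² samples, the deletions cost at most a third of them, and the remaining two thirds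
      -- still exceed the staircase bound of about s² / 2.
      k = s * s

      n≢0 : ℕ.NonZero n
      n≢0 = ℕ.>-nonZero (ℕ.<-≤-trans (ℕ.m^n>0 s 5) (ℕ.≤-trans (ℕ.m≤n*m _ 3) 3s⁵≤n))

      sparse : ∃ λ ys → (∀ {i j} → i ≢ j → lookup ys i ≢ lookup ys j) × AvoidsOn blocking ys ×
               n * k ≤ n * length ys + (k * k * k * suc B + k * k)
      sparse = ∃-avoiding {{n≢0}} blocking (suc B) sum-blocking≤ k

      ys = proj₁ sparse
      r  = length ys

      r≤triangle : r ≤ triangle (suc B)
      r≤triangle = let (_ , ys-distinct , unblocked , _) = sparse in length≤triangle tour ys ys-distinct unblocked
      -- Bounding k² by k³ turns the factor B + 1 into s, and k³ s = s⁵ k.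
      errors≤ : 3 * (k * k * k * suc B + k * k) ≤ n * k
      errors≤ = begin
        3 * (k * k * k * suc B + k * k)      ≤⟨ ℕ.*-monoʳ-≤ 3 (ℕ.+-monoʳ-≤ (k * k * k * suc B) (ℕ.m≤m*n (k * k) k)) ⟩
        3 * (k * k * k * suc B + k * k * k)  ≡⟨ solve 1 (λ b → let s = con 2 :+ b ; k = s :* s in
                                                  con 3 :* (k :* k :* k :* (con 1 :+ b) :+ k :* k :* k) := con 3 :* s :^ 5 :* k) refl B ⟩
        3 * s ^ 5 * k                        ≤⟨ ℕ.*-monoˡ-≤ k 3s⁵≤n ⟩
        n * k                                ∎

      -- Adding n k to both sides avoids subtraction on natural numbers.
      too-long : n * (2 * k) ≤ n * (3 * r)
      too-long = ℕ.+-cancelʳ-≤ (n * k) _ _ (begin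
        n * (2 * k) + n * k                                ≡⟨ solve 2 (λ n k → n :* (con 2 :* k) :+ n :* k := con 3 :* (n :* k)) refl n k ⟩
        3 * (n * k)                                        ≤⟨ ℕ.*-monoʳ-≤ 3 (proj₂ (proj₂ (proj₂ sparse))) ⟩
        3 * (n * r + (k * k * k * suc B + k * k))          ≡⟨ solve 3 (λ n r e → con 3 :* (n :* r :+ e) := n :* (con 3 :* r) :+ con 3 :* e) refl n r (k * k * k * suc B + k * k) ⟩
        n * (3 * r) + 3 * (k * k * k * suc B + k * k)      ≤⟨ ℕ.+-monoʳ-≤ (n * (3 * r)) errors≤ ⟩
        n * (3 * r) + n * k                                ∎)

      -- Doubling clears the half in the triangular number (s - 1) s / 2; strictness comes from 3 k
      -- < 4 k.
      too-short : 3 * r ℕ.< 2 * k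
      too-short = ℕ.*-cancelˡ-< 2 (3 * r) (2 * k) (begin-strict
        2 * (3 * r)                 ≤⟨ ℕ.*-monoʳ-≤ 2 (ℕ.*-monoʳ-≤ 3 r≤triangle) ⟩
        2 * (3 * triangle (suc B))  ≡⟨ solve 1 (λ t → con 2 :* (con 3 :* t) := con 3 :* (con 2 :* t)) refl (triangle (suc B)) ⟩
        3 * (2 * triangle (suc B))  ≡⟨ cong (3 *_) (2*triangle (suc B)) ⟩
        3 * (suc B * s)             ≤⟨ ℕ.*-monoʳ-≤ 3 (ℕ.*-monoˡ-≤ s (ℕ.n≤1+n (suc B))) ⟩
        3 * k                       <⟨ ℕ.*-monoˡ-< k {3} {4} ℕ.≤-refl ⟩
        4 * k                       ≡⟨ ℕ.*-assoc 2 2 k ⟩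
        2 * (2 * k)                 ∎)

allContainPath : ∀ {n s} → 2 ≤ s → 3 * s ^ 5 ≤ n → AllContainPath n 4 s
allContainPath {s = s} (s≤s (s≤s _)) 3s⁵≤n G tour with contains? G (tightPath s)
... | yes path    = path
... | no  no-path = contradiction 3s⁵≤n (LongestPaths.few-vertices G no-path tour)

-- Fifth roots

-- Abstract, as unfolding _/_ on open terms is slow.
abstract
  ι : ℕ → ℚ
  ι a = + a / 1

  ι≡/1 : ∀ a → ι a ≡ + a / 1
  ι≡/1 a = refl

  toℚᵘ-ι : ∀ a → ℚ.toℚᵘ (ι a) ℚᵘ.≃ mkℚᵘ (+ a) 0
  toℚᵘ-ι a = ℚ.toℚᵘ-fromℚᵘ (mkℚᵘ (+ a) 0)

ι-mono-≤ : ∀ {a b} → a ≤ b → ι a ℚ.≤ ι b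
ι-mono-≤ {a} {b} a≤b = ℚ.toℚᵘ-cancel-≤ (begin
  ℚ.toℚᵘ (ι a)   ≃⟨ toℚᵘ-ι a ⟩
  mkℚᵘ (+ a) 0   ≤⟨ *≤* (ℤ.*-monoʳ-≤-nonNeg (+ 1) (ℤ.+≤+ a≤b)) ⟩
  mkℚᵘ (+ b) 0   ≃⟨ toℚᵘ-ι b ⟨
  ℚ.toℚᵘ (ι b)   ∎)
  where open ℚᵘ.≤-Reasoning

ι-one : ι 1 ≡ 1ℚ
ι-one = ℚ.toℚᵘ-injective (toℚᵘ-ι 1)

ι-suc : ∀ a → ι (suc a) ≡ ι a ℚ.+ 1ℚ
ι-suc a = ℚ.toℚᵘ-injective (begin-equality
  ℚ.toℚᵘ (ι (suc a))              ≃⟨ toℚᵘ-ι (suc a) ⟩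
  mkℚᵘ (+ suc a) 0                ≃⟨ *≡* (cong (ℤ._* + 1) (trans (cong +_ (ℕ.+-comm 1 a)) (cong (ℤ._+ + 1) (sym (ℤ.*-identityʳ (+ a)))))) ⟩
  mkℚᵘ (+ a) 0 ℚᵘ.+ mkℚᵘ (+ 1) 0  ≃⟨ ℚᵘ.+-congˡ (mkℚᵘ (+ 1) 0) (toℚᵘ-ι a) ⟨
  ℚ.toℚᵘ (ι a) ℚᵘ.+ ℚ.toℚᵘ 1ℚ     ≃⟨ ℚ.toℚᵘ-homo-+ (ι a) 1ℚ ⟨
  ℚ.toℚᵘ (ι a ℚ.+ 1ℚ)             ∎)
  where open ℚᵘ.≤-Reasoning

ι-* : ∀ a b → ι (a * b) ≡ ι a ℚ.* ι b
ι-* a b = ℚ.toℚᵘ-injective (begin-equality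
  ℚ.toℚᵘ (ι (a * b))            ≃⟨ toℚᵘ-ι (a * b) ⟩
  mkℚᵘ (+ (a * b)) 0            ≃⟨ *≡* (cong (ℤ._* + 1) (ℤ.pos-* a b)) ⟩
  mkℚᵘ (+ a) 0 ℚᵘ.* mkℚᵘ (+ b) 0  ≃⟨ ℚᵘ.*-cong (toℚᵘ-ι a) (toℚᵘ-ι b) ⟨
  ℚ.toℚᵘ (ι a) ℚᵘ.* ℚ.toℚᵘ (ι b)  ≃⟨ ℚ.toℚᵘ-homo-* (ι a) (ι b) ⟨
  ℚ.toℚᵘ (ι a ℚ.* ι b)            ∎)
  where open ℚᵘ.≤-Reasoning

ι-^ : ∀ a k → ι (a ^ k) ≡ ι a ^ℚ k
ι-^ a zero    = ι-one
ι-^ a (suc k) = trans (ι-* a (a ^ k)) (cong (ι a ℚ.*_) (ι-^ a k))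

0≤ι : ∀ a → 0ℚ ℚ.≤ ι a
0≤ι a = ℚ.toℚᵘ-cancel-≤ (begin
  ℚ.toℚᵘ 0ℚ      ≤⟨ *≤* (ℤ.*-monoʳ-≤-nonNeg (+ 1) {+ 0} {+ a} (ℤ.+≤+ z≤n)) ⟩
  mkℚᵘ (+ a) 0   ≃⟨ toℚᵘ-ι a ⟨
  ℚ.toℚᵘ (ι a)   ∎)
  where open ℚᵘ.≤-Reasoning

*-mono-≤-nonNeg : ∀ {p q r s} → 0ℚ ℚ.≤ p → p ℚ.≤ q → 0ℚ ℚ.≤ r → r ℚ.≤ s → p ℚ.* r ℚ.≤ q ℚ.* s
*-mono-≤-nonNeg {p} {q} {r} {s} 0≤p p≤q 0≤r r≤s = ℚ.≤-trans
  (ℚ.*-monoʳ-≤-nonNeg r {{ℚ.nonNegative 0≤r}} p≤q)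
  (ℚ.*-monoˡ-≤-nonNeg q {{ℚ.nonNegative (ℚ.≤-trans 0≤p p≤q)}} r≤s)

0≤* : ∀ {p q} → 0ℚ ℚ.≤ p → 0ℚ ℚ.≤ q → 0ℚ ℚ.≤ p ℚ.* q
0≤* 0≤p 0≤q = *-mono-≤-nonNeg ℚ.≤-refl 0≤p ℚ.≤-refl 0≤q

0≤^ : ∀ {p} k → 0ℚ ℚ.≤ p → 0ℚ ℚ.≤ p ^ℚ k
0≤^ zero    0≤p = subst (0ℚ ℚ.≤_) ι-one (0≤ι 1)
0≤^ (suc k) 0≤p = 0≤* 0≤p (0≤^ k 0≤p)

^-monoˡ-≤ : ∀ {p q} k → 0ℚ ℚ.≤ p → p ℚ.≤ q → p ^ℚ k ℚ.≤ q ^ℚ k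
^-monoˡ-≤ zero    0≤p p≤q = ℚ.≤-refl
^-monoˡ-≤ (suc k) 0≤p p≤q = *-mono-≤-nonNeg 0≤p p≤q (0≤^ k 0≤p) (^-monoˡ-≤ k 0≤p p≤q)

square-nonNeg : ∀ p → 0ℚ ℚ.≤ p ℚ.* p
square-nonNeg p with ℚ.≤-total 0ℚ p
... | inj₁ 0≤p = 0≤* 0≤p 0≤p
... | inj₂ p≤0 = ℚ.nonNegative⁻¹ _ {{ℚ.nonPos*nonPos⇒nonPos p {{ℚ.nonPositive p≤0}} p {{ℚ.nonPositive p≤0}}}}

-- Covers ε ≥ 1, where the constant 1 - ε is not positive: p⁵ is p times the nonnegative p⁴.
^5-nonPos : ∀ {p} → p ℚ.≤ 0ℚ → p ^ℚ 5 ℚ.≤ 0ℚ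
^5-nonPos {p} p≤0 = ℚ.≤-trans
  (ℚ.*-monoʳ-≤-nonNeg (p ^ℚ 4) {{ℚ.nonNegative (subst (0ℚ ℚ.≤_) (ℚ.*-assoc p p (p ^ℚ 2)) (0≤* (square-nonNeg p)
    (subst (0ℚ ℚ.≤_) (cong (p ℚ.*_) (sym (ℚ.*-identityʳ p))) (square-nonNeg p))))}} p≤0)
  (ℚ.≤-reflexive (ℚ.*-zeroˡ (p ^ℚ 4)))

-- A positive fraction is at least the reciprocal of its denominator.
1≤ε*ι : ∀ {ε u} → 0ℚ < ε → ℚ.denominatorℕ ε ≤ u → 1ℚ ℚ.≤ ε ℚ.* ι u
1≤ε*ι {ε@(mkℚ (+ suc m) d _)} {u} _ d<u = ℚ.toℚᵘ-cancel-≤ (begin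
  ℚ.toℚᵘ 1ℚ                     ≤⟨ *≤* cross ⟩
  mkℚᵘ (+ suc m) d ℚᵘ.* mkℚᵘ (+ u) 0    ≃⟨ ℚᵘ.*-congˡ {mkℚᵘ (+ suc m) d} (toℚᵘ-ι u) ⟨
  ℚ.toℚᵘ ε ℚᵘ.* ℚ.toℚᵘ (ι u)    ≃⟨ ℚ.toℚᵘ-homo-* ε (ι u) ⟨
  ℚ.toℚᵘ (ε ℚ.* ι u)            ∎)
  where
  open ℚᵘ.≤-Reasoning
  cross : + 1 ℤ.* + (suc d * 1) ℤ.≤ (+ suc m ℤ.* + u) ℤ.* + 1
  cross = subst₂ ℤ._≤_ (sym (ℤ.*-identityˡ (+ (suc d * 1))))
    (trans (ℤ.pos-* (suc m) u) (sym (ℤ.*-identityʳ (+ suc m ℤ.* + u))))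
    (ℤ.+≤+ (ℕ.≤-trans (ℕ.≤-reflexive (ℕ.*-identityʳ (suc d))) (ℕ.≤-trans d<u (ℕ.m≤n*m u (suc m)))))
1≤ε*ι {mkℚ (+ zero) _ _} (ℚ.*<* (ℤ.+<+ ())) _
1≤ε*ι {mkℚ (ℤ.-[1+ _ ]) _ _} (ℚ.*<* ()) _

-- s is the integer part of the real fifth root of n / 3; searching up to n suffices because a ≤ 3
-- a⁵.
fifthRoot : ∀ n b → 3 * b ^ 5 ≤ n → ∃ λ s → b ≤ s × 3 * s ^ 5 ≤ n × n ≤ 3 * suc s ^ 5
fifthRoot n b 3b⁵≤n = s
  , largest≤-max P? n b (≤n b 3b⁵≤n) 3b⁵≤n
  , largest≤-sat P? z≤n n
  , ℕ.<⇒≤ (ℕ.≰⇒> λ p → ℕ.1+n≰n (largest≤-max P? n (suc s) (≤n (suc s) p) p))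
  where
  P? = λ s → 3 * s ^ 5 ℕ.≤? n
  s  = largest≤ P? n
  ≤n : ∀ a → 3 * a ^ 5 ≤ n → a ≤ n
  ≤n zero    _ = z≤n
  ≤n (suc a) p = ℕ.≤-trans (ℕ.≤-trans (ℕ.m≤m*n (suc a) (suc a ^ 4) {{ℕ.m^n≢0 (suc a) 4}}) (ℕ.m≤n*m _ 3)) p

n/3≤ι^5 : ∀ {n u} → n ≤ 3 * u ^ 5 → (+ n / 3) ℚ.≤ ι u ^ℚ 5
n/3≤ι^5 {n} {u} n≤ = subst ((+ n / 3) ℚ.≤_) (ι-^ u 5) (ℚ.toℚᵘ-cancel-≤ (begin
  ℚ.toℚᵘ (+ n / 3)           ≃⟨ ℚ.toℚᵘ-fromℚᵘ (mkℚᵘ (+ n) 2) ⟩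
  mkℚᵘ (+ n) 2               ≤⟨ *≤* cross ⟩
  mkℚᵘ (+ (u ^ 5)) 0       ≃⟨ toℚᵘ-ι (u ^ 5) ⟨
  ℚ.toℚᵘ (ι (u ^ 5))       ∎))
  where
  open ℚᵘ.≤-Reasoning
  cross : + n ℤ.* + 1 ℤ.≤ + (u ^ 5) ℤ.* + 3
  cross = subst₂ ℤ._≤_ (sym (ℤ.*-identityʳ (+ n))) (ℤ.pos-* (u ^ 5) 3)
    (ℤ.+≤+ (ℕ.≤-trans n≤ (ℕ.≤-reflexive (ℕ.*-comm 3 (u ^ 5)))))

0≤n/3 : ∀ n → 0ℚ ℚ.≤ + n / 3
0≤n/3 n = ℚ.toℚᵘ-cancel-≤ (begin
  ℚ.toℚᵘ 0ℚ          ≤⟨ *≤* (ℤ.≤-trans (ℤ.+≤+ z≤n) (ℤ.≤-reflexive (sym (ℤ.*-identityʳ (+ n))))) ⟩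
  mkℚᵘ (+ n) 2       ≃⟨ ℚ.toℚᵘ-fromℚᵘ (mkℚᵘ (+ n) 2) ⟨
  ℚ.toℚᵘ (+ n / 3)   ∎)
  where open ℚᵘ.≤-Reasoning

-- The left side is s + 1 - ε (s + 1), and ε (s + 1) is at least 1. This absorbs the loss from
-- rounding the fifth root down.
[1-ε]ι[s+1]≤ιs : ∀ {ε} s → 0ℚ < ε → ℚ.denominatorℕ ε ≤ suc s → (1ℚ - ε) ℚ.* ι (suc s) ℚ.≤ ι s
[1-ε]ι[s+1]≤ιs {ε} s 0<ε d≤s+1 = begin
  (1ℚ - ε) ℚ.* ι (suc s)                       ≡⟨ ℚ.*-distribʳ-+ (ι (suc s)) 1ℚ (ℚ.- ε) ⟩
  1ℚ ℚ.* ι (suc s) ℚ.+ (ℚ.- ε) ℚ.* ι (suc s)   ≡⟨ cong₂ ℚ._+_ (trans (ℚ.*-identityˡ (ι (suc s))) (ι-suc s)) (sym (ℚ.neg-distribˡ-* ε (ι (suc s)))) ⟩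
  (ι s ℚ.+ 1ℚ) - ε ℚ.* ι (suc s)               ≤⟨ ℚ.+-monoʳ-≤ (ι s ℚ.+ 1ℚ) (ℚ.neg-antimono-≤ (1≤ε*ι 0<ε d≤s+1)) ⟩
  (ι s ℚ.+ 1ℚ) - 1ℚ                            ≡⟨ ℚ.+-assoc (ι s) 1ℚ (ℚ.- 1ℚ) ⟩
  ι s ℚ.+ 0ℚ                                   ≡⟨ ℚ.+-identityʳ (ι s) ⟩
  ι s                                          ∎
  where open ℚ.≤-Reasoning

-- For c ≥ 0 the inequality c u ≤ f is raised to the fifth power; for c ≤ 0 the left side is at most
-- 0.
≥·⁵√-intro : ∀ {c f u n} → c ℚ.* ι u ℚ.≤ ι f → n ≤ 3 * u ^ 5 → ι f ≥ c ·⁵√ (+ n / 3)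
≥·⁵√-intro {c} {f} {u} {n} cu≤f n≤ = by-sign (ℚ.≤-total 0ℚ c)
  where
  open ℚ.≤-Reasoning
  by-sign : 0ℚ ℚ.≤ c ⊎ c ℚ.≤ 0ℚ → c ^ℚ 5 ℚ.* (+ n / 3) ℚ.≤ ι f ^ℚ 5
  by-sign (inj₁ 0≤c) = begin
    c ^ℚ 5 ℚ.* (+ n / 3)   ≤⟨ ℚ.*-monoˡ-≤-nonNeg (c ^ℚ 5) {{ℚ.nonNegative (0≤^ 5 0≤c)}} (n/3≤ι^5 n≤) ⟩
    c ^ℚ 5 ℚ.* ι u ^ℚ 5     ≡⟨ ^-distrib-* c (ι u) 5 ⟨
    (c ℚ.* ι u) ^ℚ 5       ≤⟨ ^-monoˡ-≤ 5 (0≤* 0≤c (0≤ι u)) cu≤f ⟩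
    ι f ^ℚ 5               ∎
  by-sign (inj₂ c≤0) = begin
    c ^ℚ 5 ℚ.* (+ n / 3)   ≤⟨ ℚ.*-monoʳ-≤-nonNeg (+ n / 3) {{ℚ.nonNegative (0≤n/3 n)}} (^5-nonPos c≤0) ⟩
    0ℚ ℚ.* (+ n / 3)      ≡⟨ ℚ.*-zeroˡ (+ n / 3) ⟩
    0ℚ                    ≤⟨ 0≤^ 5 (0≤ι f) ⟩
    ι f ^ℚ 5               ∎

theorem26 : (ε : ℚ) → 0ℚ < ε → ∃[ N ] ((n : ℕ) → N ≤ n → (+ f₃ n 4 / 1) ≥ (1ℚ - ε) ·⁵√ (+ n / 3))
theorem26 ε 0<ε = 3 * b ^ 5 , λ n N≤n →
  let s , b≤s , 3s⁵≤n , n≤3[s+1]⁵ = fifthRoot n b N≤n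
      2≤s = ℕ.≤-trans (ℕ.m≤m+n 2 (ℚ.denominatorℕ ε)) b≤s
      d≤s+1 = ℕ.m≤n⇒m≤1+n (ℕ.≤-trans (ℕ.m≤n+m (ℚ.denominatorℕ ε) 2) b≤s)
      s≤f = proj₂ (f₃-isMaximum n 4 (ℕ.m≤m+n 4 2)) s (allContainPath 2≤s 3s⁵≤n)
  in subst (_≥ (1ℚ - ε) ·⁵√ (+ n / 3)) (ι≡/1 (f₃ n 4))
       (≥·⁵√-intro {1ℚ - ε} {f₃ n 4} {suc s} {n} (ℚ.≤-trans ([1-ε]ι[s+1]≤ιs s 0<ε d≤s+1) (ι-mono-≤ s≤f)) n≤3[s+1]⁵)
  where
  -- The 2 ensures that s is at least 2, as `allContainPath` requires; the denominator ensures ε (s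
  -- + 1) ≥ 1.
  b = 2 + ℚ.denominatorℕ ε
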